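{- Let $\lambda,m,n$ be positive integers and $T$ a 2-factor type. If $OP(\lambda mK_n;T)$ has a solution, then $OP(\lambda K_{n\times m};mT)$ has a solution.
   Context: $\lambda K_n$: complete multigraph on $n$ vertices with $\lambda$ parallel edges per pair; $\lambda K_{n\times m}$: complete $\lambda$-fold $n$-partite multigraph with parts of size $m$. A 2-factor has type $[c_1,\ldots,c_t]$ if it is a disjoint union of cycles of lengths $c_1,\ldots,c_t$; $mT=[mx:x\in T]$. A 2-factorization of an $r$-regular graph is a decomposition into $\lfloor r/2\rfloor$ 2-factors plus a single 1-factor if $r$ is odd. $OP(\mathcal{G};T)$ (Oberwolfach Problem) asks whether $\mathcal{G}$ admits a 2-factorization in which every 2-factor has type $T$; it "has a solution" if such a 2-factorization exists. -}

module Defs where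

open import Data.Nat using (ℕ; zero; suc; _+_; _*_; _≤_)
open import Data.Bool using (Bool; if_then_else_)
open import Data.Fin using (Fin)
import Data.Fin.Properties as FinP
open import Data.List using (List; []; _∷_; _++_; map; concat; concatMap; length; allFin; cartesianProduct; [_])
open import Data.Nat.ListAction using (sum)
open import Data.List.Relation.Unary.All using (All)
open import Data.List.Relation.Binary.Permutation.Propositional using (_↭_)
open import Data.Maybe using (Maybe; just; nothing)
open import Data.Product using (Σ; _×_; _,_)
open import Data.Product.Properties using (≡-dec)
open import Data.Sum using (_⊎_)
open import Relation.Binary.Definitions using (DecidableEquality)
open import Relation.Binary.PropositionalEquality using (_≡_; _≢_)
open import Relation.Nullary using (Dec; yes; no)
open import Relation.Nullary.Decidable using (⌊_⌋; _×-dec_; _⊎-dec_)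

-- A finite multigraph (without loops): a vertex type with decidable equality,
-- the list of all its vertices (duplicate-free), and an edge multiplicity
-- function (mult u v = number of parallel edges between u and v, for u ≢ v).
record Graph : Set₁ where
  field
    V     : Set
    _≟V_  : DecidableEquality V
    verts : List V
    mult  : V → V → ℕ

module _ (G : Graph) where
  open Graph G

  cycEdges : List V → List (V × V)
  cycEdges []       = []
  cycEdges (x ∷ xs) = go x (x ∷ xs)
    where
    go : V → List V → List (V × V)
    go x₀ []            = []
    go x₀ (y ∷ [])      = (y , x₀) ∷ []
    go x₀ (y ∷ z ∷ zs)  = (y , z) ∷ go x₀ (z ∷ zs)

  countEdge : V → V → List (V × V) → ℕ
  countEdge u v []              = 0
  countEdge u v ((a , b) ∷ es) with ((a ≟V u) ×-dec (b ≟V v)) ⊎-dec ((a ≟V v) ×-dec (b ≟V u))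
  ... | yes _ = suc (countEdge u v es)
  ... | no  _ = countEdge u v es

  TwoFactor : List ℕ → Set
  TwoFactor T = Σ (List (List V)) λ cs →
    All (λ c → 2 ≤ length c) cs × (concat cs ↭ verts) × (map length cs ↭ T)

  twoFactorEdges : {T : List ℕ} → TwoFactor T → List (V × V)
  twoFactorEdges (cs , _) = concatMap cycEdges cs

  OneFactor : Set
  OneFactor = Σ (List (V × V)) λ ps →
    All (λ p → Data.Product.proj₁ p ≢ Data.Product.proj₂ p) ps ×
    (concatMap (λ p → Data.Product.proj₁ p ∷ Data.Product.proj₂ p ∷ []) ps ↭ verts)

  oneFactorEdges : Maybe OneFactor → List (V × V)
  oneFactorEdges nothing          = []
  oneFactorEdges (just (ps , _))  = ps

  -- OP(G;T) has a solution: G decomposes into 2-factors all of type T,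
  -- plus possibly a single 1-factor (which for a regular graph is present
  -- exactly when the degree is odd, the number of 2-factors then being
  -- ⌊r/2⌋ automatically by counting degrees).
  OP : List ℕ → Set
  OP T = Σ (List (TwoFactor T)) λ Fs → Σ (Maybe OneFactor) λ M →
    ∀ u v → u ≢ v →
      sum (map (λ F → countEdge u v (twoFactorEdges F)) Fs)
        + countEdge u v (oneFactorEdges M) ≡ mult u v

completeMulti : (lam n : ℕ) → Graph
completeMulti lam n = record
  { V = Fin n ; _≟V_ = FinP._≟_ ; verts = allFin n
  ; mult = λ u v → if ⌊ u FinP.≟ v ⌋ then 0 else lam }

completeMultipartite : (lam n m : ℕ) → Graph
completeMultipartite lam n m = record
  { V = Fin n × Fin m ; _≟V_ = ≡-dec FinP._≟_ FinP._≟_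
  ; verts = cartesianProduct (allFin n) (allFin m)
  ; mult = λ { (i , a) (j , b) → if ⌊ i FinP.≟ j ⌋ then 0 else lam } }

scaleType : ℕ → List ℕ → List ℕ
scaleType m T = map (m *_) T

{-# OPTIONS --safe #-}
-- Give every vertex of λmK_n weight m: walk m times round each cycle of each
-- 2-factor and repeat the 1-factor m times.  The vertices of a part are then
-- split off one by one.  To move one unit from a vertex u of weight K ≥ 2 to a new
-- vertex u′, cut every closed walk through u into its K trails from u to u, choose
-- two ends of distinct trails in each of them (and one edge of the 1-factor at u),
-- and attach these ends to u′; the trails can be reassembled into one closed walk
-- of the same length.  The chosen ends must lead to each vertex w outside the part in
-- exactly the proportion 1/K.  Such a choice is a perfect matching in a K-regular
-- bipartite multigraph: on one side the trails, each with its two ends and K - 2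
-- dummy edges to a node of its walk that absorbs K - 2 trails; on the other
-- the vertices w, with multiplicity.
module Submission where

open import Defs
open import Data.Bool using (if_then_else_)
open import Data.Empty using (⊥-elim)
open import Data.Fin using (Fin; zero; suc)
import Data.Fin.Properties as FinP
open import Data.List
  using (List; []; _∷_; _++_; map; concat; concatMap; length; filter; mapMaybe;
         replicate; reverse; tabulate; allFin; cartesianProduct)
open import Data.List.Membership.Propositional using (_∈_; _∉_; find)
open import Data.List.Membership.Propositional.Properties
import Data.List.Membership.DecPropositional as DecMembership
open import Data.List.Properties
open import Data.List.Relation.Binary.Permutation.Propositional renaming (trans to transitive)
open import Data.List.Relation.Binary.Permutation.Propositional.Properties
  using (All-resp-↭; ∈-resp-↭; map⁺; ↭-map-inv; ↭-length; ++⁺ˡ; ++⁺ʳ; ++⁺; shift; shifts; drop-∷;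
         ∷↭∷ʳ; ↭-reverse; filter-↭; mapMaybe-↭; ++-commutativeMonoid)
  renaming (++-comm to ++-comm-↭)
import Data.List.Relation.Binary.Permutation.Setoid.Properties as PermutationSetoid
open import Data.List.Relation.Binary.Pointwise using (Pointwise; []; _∷_)
open import Data.List.Relation.Unary.All as All using (All; []; _∷_)
import Data.List.Relation.Unary.All.Properties as AllP
open import Data.List.Relation.Unary.AllPairs as AllPairs using ([]; _∷_)
open import Data.List.Relation.Unary.Any as Any using (here; there)
open import Data.List.Relation.Unary.Unique.Propositional using (Unique)
open import Data.List.Relation.Unary.Unique.Propositional.Properties
  using (allFin⁺; cartesianProduct⁺; Unique[x∷xs]⇒x∉xs)
  renaming (map⁺ to Unique-map⁺)
open import Data.Maybe using (Maybe; just; nothing)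
open import Data.Nat using (ℕ; zero; suc; _+_; _*_; _≤_; s≤s)
open import Data.Nat.ListAction using (sum)
open import Data.Nat.Properties
open import Data.Product using (Σ; ∃; ∃₂; _×_; _,_; proj₁; proj₂)
open import Data.Sum using (_⊎_; inj₁; inj₂; isInj₁; isInj₂)
import Data.Sum.Properties as SumP
open import Data.Unit using (⊤; tt)
open import Function using (_∘_; id; case_of_)
open import Relation.Binary.Bundles using (Setoid)
open import Relation.Binary.Definitions using (DecidableEquality)
open import Relation.Binary.PropositionalEquality
import Relation.Binary.Reasoning.Setoid as SetoidReasoning
open import Relation.Nullary using (¬_; Dec; yes; no; contradiction)
open import Relation.Nullary.Decidable using (⌊_⌋; _×-dec_; _⊎-dec_)
open import Relation.Unary using (Decidable)
open import Relation.Unary.Properties using (∁?)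
import Algebra.Solver.CommutativeMonoid as CommutativeMonoidSolver
open import Algebra.Properties.CommutativeSemigroup *-commutativeSemigroup using (x∙yz≈y∙xz)

-- This is the method of amalgamations and detachments. The invariant: all pieces together join `a`
-- and `b` exactly λ · weight(a) · weight(b) times if their parts differ, and not at all otherwise.
-- It explains the multiplicity λm in the hypothesis, since m rounds through λm edges give λ · m ·
-- m, and with all weights 1 it is the edge count of the conclusion. It also yields the regularity:
-- u meets w in K · λ · weight(w) edges, so w has to be picked λ · weight(w) times. The obstacle is
-- connectedness. Correct degrees alone would let a piece fall apart into several closed walks: if
-- both ends moved to u′ belonged to one trail, that trail and u′ would close up on their own. Ends
-- of distinct trails σ and ρ do no harm, because u′ σ u ... u ρ⁻¹ u′ is a single walk that can take
-- in all the other trails. A matching picks one entry per trail, so distinctness is automatic; the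
-- dummies only have to enforce that exactly two trails are touched.

private variable
  A C : Set

-- Repeated lists, their lengths and permutations

copies : ℕ → List A → List A
copies k xs = concat (replicate k xs)

∈⇒↭∷ : ∀ {x : A} {xs} → x ∈ xs → ∃ λ ys → xs ↭ x ∷ ys
∈⇒↭∷ x∈xs with ∈-∃++ x∈xs
... | ys , zs , refl = ys ++ zs , shift _ ys zs

length-copies : ∀ k (xs : List A) → length (copies k xs) ≡ k * length xs
length-copies zero    xs = refl
length-copies (suc k) xs =
  trans (length-++ xs) (cong (length xs +_) (length-copies k xs))

filter-copies : ∀ {P : A → Set} (P? : Decidable P) k xs →
  filter P? (copies k xs) ≡ copies k (filter P? xs)
filter-copies P? zero    xs = refl
filter-copies P? (suc k) xs =
  trans (filter-++ P? xs _) (cong (filter P? xs ++_) (filter-copies P? k xs))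

length-concat : ∀ {k} {xss : List (List A)} → All (λ xs → length xs ≡ k) xss →
  length (concat xss) ≡ length xss * k
length-concat []                          = refl
length-concat {xss = xs ∷ _} (refl ∷ all) =
  trans (length-++ xs) (cong (length xs +_) (length-concat all))

concat-↭ : ∀ {xss yss : List (List A)} → xss ↭ yss → concat xss ↭ concat yss
concat-↭ refl            = refl
concat-↭ (prep xs p)     = ++⁺ˡ xs (concat-↭ p)
concat-↭ (swap xs ys p) =
  ↭-trans (shifts xs ys) (++⁺ˡ ys (++⁺ˡ xs (concat-↭ p)))
concat-↭ (transitive p q) = ↭-trans (concat-↭ p) (concat-↭ q)

-- Perfect matchings in regular bipartite multigraphs, one side given by its lists of neighbours

module Selection {A : Set} (_≟_ : DecidableEquality A) where
  open DecMembership _≟_ using (_∈?_)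

  -- Row, pick and membership travel together, so one permutation of choices permutes rows and picks
  -- alike, while each of the two is compared only up to order.
  record Choice : Set where
    constructor choice
    field
      {row}   : List A
      {picked} : A
      pick∈row : picked ∈ row
  open Choice

  rows : List Choice → List (List A)
  rows = map row

  picks : List Choice → List A
  picks = map picked

  Selects : List (List A) → List A → Set
  Selects xss ys = ∃ λ M → rows M ↭ xss × picks M ↭ ys

  -- Alternating-path argument without paths: Z collects the rows whose whole
  -- content is already reachable, in the sense that any of their entries can be
  -- added to the selection.
  augment : ∀ {k} n (M : List Choice) → length M ≡ n → ∀ Z W Q U D →
    (∀ {y} → y ∈ concat Z → Selects Z (y ∷ Q)) →
    length Z ≡ suc (length Q) →
    All (λ xs → length xs ≡ suc k) Z →
    All (λ xs → length xs ≡ suc k) (rows M) →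
    concat (Z ++ rows M ++ W) ↭ copies (suc k) D →
    D ↭ Q ++ picks M ++ U →
    ∃₂ λ y U′ → U ↭ y ∷ U′ × Selects (Z ++ rows M) (y ∷ Q ++ picks M)
  augment {k} n M |M| Z W Q U D reach |Z| lenZ lenM total D↭
    -- `U` is the part of the demand `D` not yet met, `Q` the part that was met by rows since moved
    -- from `M` to `Z`, and `W` the rows still to be treated. `Z` has one row more than `Q`, namely
    -- the new row, which has no pick yet.
    with Any.any? (_∈? concat Z) U
  ... | yes y∈ =
    let y , y∈U , y∈Z = find y∈
        U′ , U↭ = ∈⇒↭∷ y∈U
        N , rN , pN = reach y∈Z
    in y , U′ , U↭ , N ++ M
      , ↭-trans (↭-reflexive (map-++ row N M)) (++⁺ʳ (rows M) rN)
      , ↭-trans (↭-reflexive (map-++ picked N M)) (++⁺ʳ (picks M) pN)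
  ... | no U∩Z with Any.any? (λ c → picked c ∈? concat Z) M
  -- Hall's condition by counting: here the values occurring in `Z` occur in `D` only within `Q`,
  -- hence at most (k+1)|Q| times in `copies (suc k) D`, yet the rows of `Z` alone hold (k+1)(|Q|+1)
  -- of them.
  ...   | no M∩Z = ⊥-elim (<-irrefl refl (begin-strict
      suc k * length Q                          <⟨ *-monoʳ-< (suc k) (n<1+n (length Q)) ⟩
      suc k * suc (length Q)                    ≡⟨ cong (suc k *_) |Z| ⟨
      suc k * length Z                          ≡⟨ *-comm (suc k) (length Z) ⟩
      length Z * suc k                          ≡⟨ length-concat lenZ ⟨
      length (concat Z)                         ≡⟨ cong length (filter-all S? (All.tabulate id)) ⟨
      length (filter S? (concat Z))             ≤⟨ m≤m+n _ _ ⟩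
      length (filter S? (concat Z)) + length (filter S? (concat (rows M ++ W)))
                                                ≡⟨ length-++ (filter S? (concat Z)) ⟨
      length (filter S? (concat Z) ++ filter S? (concat (rows M ++ W)))
                                                ≡⟨ cong length (filter-++ S? (concat Z) _) ⟨
      length (filter S? (concat Z ++ concat (rows M ++ W)))
                                                ≡⟨ cong (length ∘ filter S?) (concat-++ Z (rows M ++ W)) ⟩
      length (filter S? (concat (Z ++ rows M ++ W))) ≡⟨ ↭-length (filter-↭ S? total) ⟩
      length (filter S? (copies (suc k) D))     ≡⟨ cong length (filter-copies S? (suc k) D) ⟩
      length (copies (suc k) (filter S? D))     ≡⟨ length-copies (suc k) (filter S? D) ⟩
      suc k * length (filter S? D)              ≡⟨ cong (suc k *_) (↭-length (filter-↭ S? D↭)) ⟩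
      suc k * length (filter S? (Q ++ picks M ++ U)) ≡⟨ cong (λ l → suc k * length l) onlyQ ⟩
      suc k * length (filter S? Q)              ≤⟨ *-monoʳ-≤ (suc k) (length-filter S? Q) ⟩
      suc k * length Q                          ∎))
    where
    open ≤-Reasoning
    S? = _∈? concat Z
    onlyQ : filter S? (Q ++ picks M ++ U) ≡ filter S? Q
    onlyQ = trans (filter-++ S? Q _) (trans (cong (filter S? Q ++_)
      (filter-none S? (AllP.++⁺ (AllP.map⁺ (AllP.¬Any⇒All¬ M M∩Z)) (AllP.¬Any⇒All¬ U U∩Z))))
      (++-identityʳ _))
  augment {k} zero [] |M| Z W Q U D reach |Z| lenZ lenM total D↭
      | no U∩Z | yes ()
  augment {k} (suc n) M |M| Z W Q U D reach |Z| lenZ lenM total D↭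
      | no U∩Z | yes M∩Z = y , U′ , U↭ , N
        , ↭-trans rN rows↭ , ↭-trans pN (prep y picks↭)
    where
    c = proj₁ (find M∩Z)
    c∈M = proj₁ (proj₂ (find M∩Z))
    c∈Z = proj₂ (proj₂ (find M∩Z))
    M′ = proj₁ (∈⇒↭∷ c∈M)
    M↭ : M ↭ c ∷ M′
    M↭ = proj₂ (∈⇒↭∷ c∈M)
    r = row c
    lenM′ : All (λ xs → length xs ≡ suc k) (rows (c ∷ M′))
    lenM′ = All-resp-↭ (map⁺ row M↭) lenM
    -- The switch along an alternating path: `r` gives up its pick for `y`, and the rows of `Z`
    -- supply that pick in addition to `Q`. For an entry of `Z` the choice `c` stays as it is.
    reach′ : ∀ {y} → y ∈ concat (r ∷ Z) → Selects (r ∷ Z) (y ∷ picked c ∷ Q)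
    reach′ y∈ with ∈-++⁻ r y∈
    ... | inj₁ y∈r = let N , rN , pN = reach c∈Z in
      choice y∈r ∷ N , prep r rN , prep _ pN
    ... | inj₂ y∈Z = let N , rN , pN = reach y∈Z in
      c ∷ N , prep r rN , ↭-trans (prep (picked c) pN) (swap _ _ refl)
    rows↭ : r ∷ Z ++ rows M′ ↭ Z ++ rows M
    rows↭ = ↭-trans (↭-sym (shift r Z (rows M′))) (++⁺ˡ Z (↭-sym (map⁺ row M↭)))
    picks↭ : picked c ∷ Q ++ picks M′ ↭ Q ++ picks M
    picks↭ = ↭-trans (↭-sym (shift _ Q (picks M′))) (++⁺ˡ Q (↭-sym (map⁺ picked M↭)))
    total′ : concat (r ∷ Z ++ rows M′ ++ W) ↭ copies (suc k) D
    total′ = ↭-trans (concat-↭ (↭-trans (↭-reflexive (cong (r ∷_) (sym (++-assoc Z (rows M′) W))))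
      (↭-trans (++⁺ʳ W rows↭) (↭-reflexive (++-assoc Z (rows M) W))))) total
    D↭′ : D ↭ picked c ∷ Q ++ picks M′ ++ U
    D↭′ = ↭-trans D↭ (↭-trans (↭-reflexive (sym (++-assoc Q (picks M) U)))
      (↭-trans (++⁺ʳ U (↭-sym picks↭)) (↭-reflexive (cong (picked c ∷_) (++-assoc Q (picks M′) U)))))
    rec = augment n M′ (suc-injective (trans (sym (↭-length M↭)) |M|)) (r ∷ Z) W (picked c ∷ Q) U D
      reach′ (cong suc |Z|) (All.head lenM′ ∷ lenZ) (All.tail lenM′) total′ D↭′
    y = proj₁ rec
    U′ = proj₁ (proj₂ rec)
    U↭ = proj₁ (proj₂ (proj₂ rec))
    N = proj₁ (proj₂ (proj₂ (proj₂ rec)))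
    rN = proj₁ (proj₂ (proj₂ (proj₂ (proj₂ rec))))
    pN = proj₂ (proj₂ (proj₂ (proj₂ (proj₂ rec))))

  -- Rows are served one at a time, each by an augmentation that starts with that row alone in `Z`.
  -- When no row is left, comparing lengths in `total` shows that no demand is left either.
  extend : ∀ {k} (M : List Choice) W U D →
    All (λ xs → length xs ≡ suc k) (rows M) → All (λ xs → length xs ≡ suc k) W →
    concat (rows M ++ W) ↭ copies (suc k) D → D ↭ picks M ++ U →
    Selects (rows M ++ W) D
  extend {k} M [] U D lenM lenW total D↭ =
    M , ↭-reflexive (sym (++-identityʳ _)) ,
    ↭-sym (↭-trans D↭ (↭-reflexive (trans (cong (picks M ++_) (empty U |U|)) (++-identityʳ _))))
    where
    open ≡-Reasoning
    empty : ∀ (xs : List A) → length xs ≡ 0 → xs ≡ []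
    empty [] _ = refl
    |M| : length D ≡ length M
    |M| = *-cancelˡ-≡ _ _ (suc k) (begin
      suc k * length D               ≡⟨ length-copies (suc k) D ⟨
      length (copies (suc k) D)      ≡⟨ ↭-length total ⟨
      length (concat (rows M ++ [])) ≡⟨ length-concat (AllP.++⁺ lenM []) ⟩
      length (rows M ++ []) * suc k  ≡⟨ cong (λ l → length l * suc k) (++-identityʳ (rows M)) ⟩
      length (rows M) * suc k        ≡⟨ cong (_* suc k) (length-map row M) ⟩
      length M * suc k               ≡⟨ *-comm (length M) (suc k) ⟩
      suc k * length M               ∎)
    |U| : length U ≡ 0
    |U| = +-cancelˡ-≡ (length M) _ _ (begin
      length M + length U         ≡⟨ cong (_+ length U) (length-map picked M) ⟨
      length (picks M) + length U ≡⟨ length-++ (picks M) ⟨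
      length (picks M ++ U)       ≡⟨ ↭-length D↭ ⟨
      length D                    ≡⟨ |M| ⟩
      length M                    ≡⟨ +-identityʳ _ ⟨
      length M + 0                ∎)
  extend {k} M (w ∷ W) U D lenM (lw ∷ lenW) total D↭ =
    let y , U′ , U↭ , N , rN , pN =
          augment (length M) M refl (w ∷ []) W [] U D reach refl (lw ∷ []) lenM
            (↭-trans (concat-↭ (↭-sym (shift w (rows M) W))) total) D↭
        moved = ↭-trans (++⁺ʳ W rN) (↭-sym (shift w (rows M) W))
        N′ , rN′ , pN′ = extend N W U′ D (All-resp-↭ (↭-sym rN) (lw ∷ lenM)) lenW
          (↭-trans (concat-↭ moved) total)
          (↭-trans D↭ (↭-trans (++⁺ˡ (picks M) U↭) (↭-trans (shift y (picks M) U′)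
            (++⁺ʳ U′ (↭-sym pN)))))
    in N′ , ↭-trans rN′ moved , pN′
    where
    reach : ∀ {y} → y ∈ w ++ [] → Selects (w ∷ []) (y ∷ [])
    reach y∈ = choice (subst (_ ∈_) (++-identityʳ w) y∈) ∷ [] , refl , refl

  -- König's theorem on perfect matchings of regular bipartite multigraphs. The picks come back in
  -- the order of the given rows, since they are decoded trail by trail later.
  selection : ∀ {k} xss D → All (λ xs → length xs ≡ suc k) xss →
    concat xss ↭ copies (suc k) D → ∃ λ ps → Pointwise _∈_ ps xss × ps ↭ D
  selection xss D len total with extend [] xss D D [] len total refl
  ... | M , rM , pM with ↭-map-inv row rM
  ...   | M′ , refl , M↭M′ = picks M′ , picks-∈ M′ ,
    ↭-trans (map⁺ picked (↭-sym M↭M′)) pM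
    where
    picks-∈ : ∀ N → Pointwise _∈_ (picks N) (rows N)
    picks-∈ []      = []
    picks-∈ (c ∷ N) = pick∈row c ∷ picks-∈ N

copies-[] : ∀ k → copies k [] ≡ ([] {A = A})
copies-[] zero    = refl
copies-[] (suc k) = copies-[] k

-- Occurrence counts, and permutations obtained from equal counts

module Counting {A : Set} (_≟_ : DecidableEquality A) where

  count : A → List A → ℕ
  count x xs = length (filter (x ≟_) xs)

  count-++ : ∀ x xs ys → count x (xs ++ ys) ≡ count x xs + count x ys
  count-++ x xs ys = trans (cong length (filter-++ (x ≟_) xs ys)) (length-++ (filter (x ≟_) xs))

  count-↭ : ∀ x {xs ys} → xs ↭ ys → count x xs ≡ count x ys
  count-↭ x p = ↭-length (filter-↭ (x ≟_) p)

  count-copies : ∀ x k xs → count x (copies k xs) ≡ k * count x xs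
  count-copies x k xs = trans (cong length (filter-copies (x ≟_) k xs)) (length-copies k _)

  count-∉ : ∀ {x xs} → x ∉ xs → count x xs ≡ 0
  count-∉ {x} x∉xs = cong length (filter-none (x ≟_) (AllP.¬Any⇒All¬ _ x∉xs))

  count-refl : ∀ x → count x (x ∷ []) ≡ 1
  count-refl x = cong length (filter-accept (x ≟_) {xs = []} refl)

  count-≢ : ∀ {x y} → x ≢ y → count x (y ∷ []) ≡ 0
  count-≢ x≢y = cong length (filter-reject (_ ≟_) {xs = []} x≢y)

  count-∈ : ∀ {x xs} → x ∈ xs → count x xs ≢ 0
  count-∈ {x} x∈xs eq = <-irrefl (sym eq) (filter-some (x ≟_) x∈xs)

  count≢0⇒∈ : ∀ {x} xs → count x xs ≢ 0 → x ∈ xs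
  count≢0⇒∈ {x} xs c≢0 with Any.any? (x ≟_) xs
  ... | yes x∈xs = x∈xs
  ... | no  x∉xs = contradiction (count-∉ x∉xs) c≢0

  count-replicate : ∀ x n → count x (replicate n x) ≡ n
  count-replicate x n = trans (cong length (filter-all (x ≟_) (AllP.replicate⁺ n refl))) (length-replicate n)

  count-≡⇒↭ : ∀ xs ys → (∀ x → count x xs ≡ count x ys) → xs ↭ ys
  count-≡⇒↭ []       []       eq = refl
  count-≡⇒↭ []       (y ∷ ys) eq = contradiction (sym (eq y)) (count-∈ {xs = y ∷ ys} (here refl))
  count-≡⇒↭ (x ∷ xs) ys eq =
    let ys′ , ys↭ = ∈⇒↭∷ (count≢0⇒∈ ys (count-∈ {xs = x ∷ xs} (here refl) ∘ trans (eq x)))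
    in ↭-trans (prep x (count-≡⇒↭ xs ys′ λ y → +-cancelˡ-≡ (count y (x ∷ [])) _ _
         (trans (sym (count-++ y (x ∷ []) xs)) (trans (eq y) (trans (count-↭ y ys↭) (count-++ y (x ∷ []) ys′))))))
       (↭-sym ys↭)

-- For a walk cut at `u`, this reads off both the number of trails and the multiset of the remaining
-- vertices.
replicate-++-cancel : ∀ {u : A} a b {X Y} → u ∉ X → u ∉ Y →
  replicate a u ++ X ↭ replicate b u ++ Y → a ≡ b × X ↭ Y
replicate-++-cancel zero    zero    u∉X u∉Y p = refl , p
replicate-++-cancel zero    (suc b) u∉X u∉Y p = contradiction (∈-resp-↭ (↭-sym p) (here refl)) u∉X
replicate-++-cancel (suc a) zero    u∉X u∉Y p = contradiction (∈-resp-↭ p (here refl)) u∉Y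
replicate-++-cancel (suc a) (suc b) u∉X u∉Y p =
  let a≡b , X↭Y = replicate-++-cancel a b u∉X u∉Y (drop-∷ p) in cong suc a≡b , X↭Y

concatMap-∷-↭ : ∀ (u : A) ts → concatMap (u ∷_) ts ↭ replicate (length ts) u ++ concat ts
concatMap-∷-↭ u []       = refl
concatMap-∷-↭ u (t ∷ ts) = prep u (↭-trans (++⁺ˡ t (concatMap-∷-↭ u ts))
  (shifts t (replicate (length ts) u)))

concat-∉ : ∀ {u : A} {ts} → All (u ∉_) ts → u ∉ concat ts
concat-∉ {ts = ts} all u∈ with find (∈-concat⁻ ts u∈)
... | t , t∈ , u∈t = All.lookup all t∈ u∈t

-- Edge multisets and closed walks

module Walks (G : Graph) where
  open Graph G

  Edges : Set
  Edges = List (V × V)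

  private
    joins? : ∀ u v → Decidable (λ (e : V × V) → (proj₁ e ≡ u × proj₂ e ≡ v) ⊎ (proj₁ e ≡ v × proj₂ e ≡ u))
    joins? u v (a , b) = ((a ≟V u) ×-dec (b ≟V v)) ⊎-dec ((a ≟V v) ×-dec (b ≟V u))

    countEdge-filter : ∀ u v es → countEdge G u v es ≡ length (filter (joins? u v) es)
    countEdge-filter u v []             = refl
    countEdge-filter u v ((a , b) ∷ es)
      with ((a ≟V u) ×-dec (b ≟V v)) ⊎-dec ((a ≟V v) ×-dec (b ≟V u))
    ... | yes j = trans (cong suc (countEdge-filter u v es)) (sym (cong length (filter-accept (joins? u v) j)))
    ... | no ¬j = trans (countEdge-filter u v es) (sym (cong length (filter-reject (joins? u v) ¬j)))

  countEdge-++ : ∀ u v es fs → countEdge G u v (es ++ fs) ≡ countEdge G u v es + countEdge G u v fs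
  countEdge-++ u v es fs = trans (countEdge-filter u v (es ++ fs)) (trans
    (cong length (filter-++ (joins? u v) es fs)) (trans (length-++ (filter (joins? u v) es))
    (sym (cong₂ _+_ (countEdge-filter u v es) (countEdge-filter u v fs)))))

  countEdge-↭ : ∀ u v {es fs} → es ↭ fs → countEdge G u v es ≡ countEdge G u v fs
  countEdge-↭ u v {es} {fs} p = trans (countEdge-filter u v es)
    (trans (↭-length (filter-↭ (joins? u v) p)) (sym (countEdge-filter u v fs)))

  countEdge-none : ∀ u v es → (∀ {a b} → (a , b) ∈ es → ¬ ((a ≡ u × b ≡ v) ⊎ (a ≡ v × b ≡ u))) →
    countEdge G u v es ≡ 0
  countEdge-none u v es none = trans (countEdge-filter u v es)
    (cong length (filter-none (joins? u v) (All.tabulate λ e∈ → none e∈)))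

  countEdge-one : ∀ u v a b → (a ≡ u × b ≡ v) ⊎ (a ≡ v × b ≡ u) → countEdge G u v ((a , b) ∷ []) ≡ 1
  countEdge-one u v a b j = trans (countEdge-filter u v _) (cong length (filter-accept (joins? u v) {xs = []} j))

  countEdge-∈ : ∀ {u v es} → (u , v) ∈ es → countEdge G u v es ≢ 0
  countEdge-∈ {u} {v} e∈ eq with ∈⇒↭∷ e∈
  ... | es′ , p with trans (sym eq) (trans (countEdge-↭ u v p)
        (trans (countEdge-++ u v ((u , v) ∷ []) es′) (cong (_+ countEdge G u v es′) (countEdge-one u v u v (inj₁ (refl , refl))))))
  ...   | ()

  countEdge-comm : ∀ u v es → countEdge G u v es ≡ countEdge G v u es
  countEdge-comm u v []             = refl
  countEdge-comm u v ((a , b) ∷ es)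
    with ((a ≟V u) ×-dec (b ≟V v)) ⊎-dec ((a ≟V v) ×-dec (b ≟V u))
       | ((a ≟V v) ×-dec (b ≟V u)) ⊎-dec ((a ≟V u) ×-dec (b ≟V v))
  ... | yes _        | yes _        = cong suc (countEdge-comm u v es)
  ... | no  _        | no  _        = countEdge-comm u v es
  ... | yes (inj₁ p) | no  ¬q       = contradiction (inj₂ p) ¬q
  ... | yes (inj₂ p) | no  ¬q       = contradiction (inj₁ p) ¬q
  ... | no  ¬p       | yes (inj₁ q) = contradiction (inj₂ q) ¬p
  ... | no  ¬p       | yes (inj₂ q) = contradiction (inj₁ q) ¬p

  infix 4 _≅_
  -- Equality of multisets of undirected edges. The diagonal u = v is included, so that absence of
  -- loops carries over; the record keeps `es` and `fs` visible to unification.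
  record _≅_ (es fs : Edges) : Set where
    constructor same
    field at : ∀ u v → countEdge G u v es ≡ countEdge G u v fs
  open _≅_ public

  ≅-refl : ∀ {es} → es ≅ es
  ≅-refl = same λ _ _ → refl

  ≅-sym : ∀ {es fs} → es ≅ fs → fs ≅ es
  ≅-sym p = same λ u v → sym (at p u v)

  ≅-trans : ∀ {es fs gs} → es ≅ fs → fs ≅ gs → es ≅ gs
  ≅-trans p q = same λ u v → trans (at p u v) (at q u v)

  ≅-reflexive : ∀ {es fs} → es ≡ fs → es ≅ fs
  ≅-reflexive refl = ≅-refl

  ↭⇒≅ : ∀ {es fs} → es ↭ fs → es ≅ fs
  ↭⇒≅ p = same λ u v → countEdge-↭ u v p

  ≅-++ : ∀ {es es′ fs fs′} → es ≅ es′ → fs ≅ fs′ → es ++ fs ≅ es′ ++ fs′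
  ≅-++ {es} {es′} {fs} {fs′} p q = same λ u v → trans (countEdge-++ u v es fs)
    (trans (cong₂ _+_ (at p u v) (at q u v)) (sym (countEdge-++ u v es′ fs′)))

  ≅-∷ : ∀ e {fs fs′} → fs ≅ fs′ → e ∷ fs ≅ e ∷ fs′
  ≅-∷ e = ≅-++ {e ∷ []} ≅-refl

  ≅-setoid : Setoid _ _
  ≅-setoid = record { _≈_ = _≅_ ; isEquivalence = record { refl = ≅-refl ; sym = ≅-sym ; trans = ≅-trans } }

  module ≅-Reasoning = SetoidReasoning ≅-setoid
  module EdgeSolver = CommutativeMonoidSolver (++-commutativeMonoid {A = V × V})

  flip-≅ : ∀ a b → (a , b) ∷ [] ≅ (b , a) ∷ []
  flip-≅ a b = same λ u v → flipped u v
    where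
    flipped : ∀ u v → countEdge G u v ((a , b) ∷ []) ≡ countEdge G u v ((b , a) ∷ [])
    flipped u v
      with ((a ≟V u) ×-dec (b ≟V v)) ⊎-dec ((a ≟V v) ×-dec (b ≟V u))
         | ((b ≟V u) ×-dec (a ≟V v)) ⊎-dec ((b ≟V v) ×-dec (a ≟V u))
    ... | yes _              | yes _              = refl
    ... | no  _              | no  _              = refl
    ... | yes (inj₁ (p , q)) | no  ¬q             = contradiction (inj₂ (q , p)) ¬q
    ... | yes (inj₂ (p , q)) | no  ¬q             = contradiction (inj₁ (q , p)) ¬q
    ... | no  ¬p             | yes (inj₁ (p , q)) = contradiction (inj₂ (q , p)) ¬p
    ... | no  ¬p             | yes (inj₂ (p , q)) = contradiction (inj₁ (q , p)) ¬p

  links : V → List V → V → Edges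
  links x []       y = (x , y) ∷ []
  links x (z ∷ zs) y = (x , z) ∷ links z zs y

  private
    linksFrom : V → List V → Edges
    linksFrom x₀ []       = []
    linksFrom x₀ (y ∷ ys) = links y ys x₀

  mutual
    -- The local loop of cycEdges has no name here; the underscore in the type
    -- of go-links is solved by that loop when cycEdges-abstract is checked.
    go-links : ∀ x xs ys → _ ≡ linksFrom x ys

    cycEdges-abstract : ∀ x xs (f : List V → Edges) → (∀ ys → f ys ≡ linksFrom x ys) →
      cycEdges G (x ∷ xs) ≡ f (x ∷ xs)
    cycEdges-abstract x xs f f≗ with x ∷ xs
    ... | ys = trans (go-links x xs ys) (sym (f≗ ys))

    go-links x xs []           = refl
    go-links x xs (y ∷ [])     = refl
    go-links x xs (y ∷ z ∷ zs) = cong ((y , z) ∷_) (go-links x xs (z ∷ zs))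

  cycEdges-links : ∀ x xs → cycEdges G (x ∷ xs) ≡ links x xs x
  cycEdges-links x xs = cycEdges-abstract x xs (linksFrom x) (λ _ → refl)

  links-++ : ∀ x xs z ys y → links x (xs ++ z ∷ ys) y ≡ links x xs z ++ links z ys y
  links-++ x []       z ys y = refl
  links-++ x (w ∷ xs) z ys y = cong ((x , w) ∷_) (links-++ w xs z ys y)

  links-reverse : ∀ x xs y → links x (reverse xs) y ≅ links y xs x
  links-reverse x []       y = flip-≅ x y
  links-reverse x (z ∷ zs) y = begin
    links x (reverse (z ∷ zs)) y            ≡⟨ cong (λ l → links x l y) (unfold-reverse z zs) ⟩
    links x (reverse zs ++ z ∷ []) y        ≡⟨ links-++ x (reverse zs) z [] y ⟩
    links x (reverse zs) z ++ (z , y) ∷ []  ≈⟨ ≅-++ (links-reverse x zs z) (flip-≅ z y) ⟩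
    links z zs x ++ (y , z) ∷ []            ≈⟨ ↭⇒≅ (∷↭∷ʳ (y , z) (links z zs x)) ⟨
    (y , z) ∷ links z zs x                  ∎
    where open ≅-Reasoning

  cycEdges-rotate : ∀ xs u ys → cycEdges G (xs ++ u ∷ ys) ≅ links u (ys ++ xs) u
  cycEdges-rotate []       u ys = ≅-reflexive (trans (cycEdges-links u ys)
    (cong (λ l → links u l u) (sym (++-identityʳ ys))))
  cycEdges-rotate (x ∷ xs) u ys = begin
    cycEdges G (x ∷ xs ++ u ∷ ys)  ≡⟨ cycEdges-links x (xs ++ u ∷ ys) ⟩
    links x (xs ++ u ∷ ys) x       ≡⟨ links-++ x xs u ys x ⟩
    links x xs u ++ links u ys x   ≈⟨ ↭⇒≅ (++-comm-↭ (links x xs u) _) ⟩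
    links u ys x ++ links x xs u   ≡⟨ links-++ u ys x xs u ⟨
    links u (ys ++ x ∷ xs) u       ∎
    where open ≅-Reasoning

  -- A closed walk through `u` as a bouquet of trails, each leaving `u` and returning to it.
  petals : V → List (List V) → Edges
  petals u = concatMap λ t → links u t u

  -- The outer ends `x` and `y` are free for the sake of the rebuilt walk: its first and last trails
  -- run to `u′`, and only those in between are petals at `u`.
  links-petals : ∀ x t u ts s y →
    links x (t ++ concatMap (u ∷_) ts ++ u ∷ s) y ≡ links x t u ++ petals u ts ++ links u s y
  links-petals x t u []        s y = links-++ x t u s y
  links-petals x t u (t′ ∷ ts) s y = begin
    links x (t ++ u ∷ (t′ ++ concatMap (u ∷_) ts) ++ u ∷ s) y
      ≡⟨ links-++ x t u _ y ⟩
    links x t u ++ links u ((t′ ++ concatMap (u ∷_) ts) ++ u ∷ s) y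
      ≡⟨ cong (λ l → links x t u ++ links u l y) (++-assoc t′ _ _) ⟩
    links x t u ++ links u (t′ ++ concatMap (u ∷_) ts ++ u ∷ s) y
      ≡⟨ cong (links x t u ++_) (trans (links-petals u t′ u ts s y) (sym (++-assoc (links u t′ u) _ _))) ⟩
    links x t u ++ petals u (t′ ∷ ts) ++ links u s y ∎
    where open ≡-Reasoning

  links-closed : ∀ u t ts → links u (t ++ concatMap (u ∷_) ts) u ≡ petals u (t ∷ ts)
  links-closed u t []        = trans (cong (λ l → links u l u) (++-identityʳ t)) (sym (++-identityʳ _))
  links-closed u t (t′ ∷ ts) = trans (links-++ u t u (t′ ++ concatMap (u ∷_) ts) u)
    (cong (links u t u ++_) (links-closed u t′ ts))

  cut : ∀ u xs → ∃₂ λ t ts → xs ≡ t ++ concatMap (u ∷_) ts × All (u ∉_) (t ∷ ts)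
  cut u []       = [] , [] , refl , (λ ()) ∷ []
  cut u (x ∷ xs) with u ≟V x | cut u xs
  ... | yes refl | t , ts , refl , away = [] , t ∷ ts , refl , (λ ()) ∷ away
  ... | no  u≢x  | t , ts , refl , u∉t ∷ away =
    x ∷ t , ts , refl , (λ { (here u≡x) → u≢x u≡x ; (there u∈t) → u∉t u∈t }) ∷ away

  endpoints : Edges → List V
  endpoints = concatMap λ e → proj₁ e ∷ proj₂ e ∷ []

  countEdge-∉ : ∀ {u} es → u ∉ endpoints es → ∀ b → countEdge G u b es ≡ 0
  countEdge-∉ {u} es u∉ b = countEdge-none u b es λ where
    e∈ (inj₁ (refl , _)) → u∉ (∈-concat⁺′ (here refl) (∈-map⁺ _ e∈))
    e∈ (inj₂ (_ , refl)) → u∉ (∈-concat⁺′ (there (here refl)) (∈-map⁺ _ e∈))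

  star : V → List V → Edges
  star u = map (u ,_)

  star-centre : ∀ u b xs → countEdge G u b (star u xs) ≡ Counting.count _≟V_ b xs
  star-centre u b []       = refl
  star-centre u b (x ∷ xs) = trans (countEdge-++ u b ((u , x) ∷ []) (star u xs))
    (trans (cong₂ _+_ (one (b ≟V x)) (star-centre u b xs)) (sym (count-++ b (x ∷ []) xs)))
    where
    open Counting _≟V_
    one : Dec (b ≡ x) → countEdge G u b ((u , x) ∷ []) ≡ count b (x ∷ [])
    one (yes refl) = trans (countEdge-one u b u b (inj₁ (refl , refl))) (sym (count-refl b))
    one (no  b≢x)  = trans (countEdge-none u b ((u , x) ∷ []) λ where
        (here refl) (inj₁ (_ , x≡b))   → b≢x (sym x≡b)
        (here refl) (inj₂ (u≡b , x≡u)) → b≢x (sym (trans x≡u u≡b)))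
      (sym (count-≢ b≢x))

  star-away : ∀ {u a b} xs → a ≢ u → b ≢ u → countEdge G a b (star u xs) ≡ 0
  star-away {u} {a} {b} xs a≢u b≢u = countEdge-none a b (star u xs) λ e∈ → λ where
    (inj₁ (refl , _)) → a≢u (cong proj₁ (proj₂ (proj₂ (∈-map⁻ (u ,_) e∈))))
    (inj₂ (refl , _)) → b≢u (cong proj₁ (proj₂ (proj₂ (∈-map⁻ (u ,_) e∈))))

  links-endpoints : ∀ {v} x xs y → v ∈ endpoints (links x xs y) → v ∈ x ∷ y ∷ xs
  links-endpoints x []       y v∈                = v∈
  links-endpoints x (z ∷ zs) y (here v≡x)        = here v≡x
  links-endpoints x (z ∷ zs) y (there (here v≡z)) = there (there (here v≡z))
  links-endpoints x (z ∷ zs) y (there (there v∈)) with links-endpoints z zs y v∈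
  ... | here v≡z         = there (there (here v≡z))
  ... | there (here v≡y) = there (here v≡y)
  ... | there (there p)  = there (there (there p))

  cycEdges-∉ : ∀ {u} xs → u ∉ xs → ∀ b → countEdge G u b (cycEdges G xs) ≡ 0
  cycEdges-∉     []       u∉ b = refl
  cycEdges-∉ {u} (x ∷ xs) u∉ b = trans (cong (countEdge G u b) (cycEdges-links x xs))
    (countEdge-∉ (links x xs x) (λ u∈ → case links-endpoints x xs x u∈ of λ where
      (here u≡x)         → u∉ (here u≡x)
      (there (here u≡x)) → u∉ (here u≡x)
      (there (there p))  → u∉ (there p)) b)

  countEdge-copies : ∀ u v k es → countEdge G u v (copies k es) ≡ k * countEdge G u v es
  countEdge-copies u v zero    es = refl
  countEdge-copies u v (suc k) es = trans (countEdge-++ u v es (copies k es))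
    (cong (countEdge G u v es +_) (countEdge-copies u v k es))

  cycEdges-copies : ∀ k xs → cycEdges G (copies (suc k) xs) ≡ copies (suc k) (cycEdges G xs)
  cycEdges-copies k []       = trans (cong (cycEdges G) (copies-[] (suc k))) (sym (copies-[] (suc k)))
  cycEdges-copies k (x ∷ xs) = trans (cycEdges-links x _)
    (trans (go k) (cong (copies (suc k)) (sym (cycEdges-links x xs))))
    where
    go : ∀ k → links x (xs ++ copies k (x ∷ xs)) x ≡ copies (suc k) (links x xs x)
    go zero    = trans (cong (λ l → links x l x) (++-identityʳ xs)) (sym (++-identityʳ _))
    go (suc k) = trans (links-++ x xs x _ x) (cong (links x xs x ++_) (go k))

  Loopless : Edges → Set
  Loopless es = ∀ v → countEdge G v v es ≡ 0

  loopless-∷ : ∀ {a b es} → a ≢ b → Loopless es → Loopless ((a , b) ∷ es)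
  loopless-∷ {a} {b} {es} a≢b loopless v = trans (countEdge-++ v v ((a , b) ∷ []) es)
    (cong₂ _+_ (countEdge-none v v ((a , b) ∷ []) λ where
      (here refl) (inj₁ (p , q)) → a≢b (trans p (sym q))
      (here refl) (inj₂ (p , q)) → a≢b (trans p (sym q))) (loopless v))

  loopless-++ : ∀ es fs → Loopless es → Loopless fs → Loopless (es ++ fs)
  loopless-++ es fs l m v = trans (countEdge-++ v v es fs) (cong₂ _+_ (l v) (m v))

  -- A one-vertex cycle would be a loop, hence the length bound; two vertices give a double edge,
  -- which is allowed.
  cycEdges-loopless : ∀ {xs} → Unique xs → 2 ≤ length xs → Loopless (cycEdges G xs)
  cycEdges-loopless {x ∷ []}     _ (s≤s ())
  cycEdges-loopless {x ∷ z ∷ zs} (x≢ ∷ uniq) _ v = trans (cong (countEdge G v v) (cycEdges-links x (z ∷ zs)))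
    (loopless-∷ (All.head x≢) (go z zs uniq x≢) v)
    where
    go : ∀ z zs → Unique (z ∷ zs) → All (x ≢_) (z ∷ zs) → Loopless (links z zs x)
    go z []       _            (x≢z ∷ _)  = loopless-∷ (λ z≡x → x≢z (sym z≡x)) λ _ → refl
    go z (w ∷ ws) (z≢ ∷ uniq) (_ ∷ x≢) = loopless-∷ (All.head z≢) (go w ws uniq x≢)

-- Lists over a disjoint sum, and rearrangements of concatenations

lefts : List (A ⊎ C) → List A
lefts = mapMaybe isInj₁

rights : List (A ⊎ C) → List C
rights = mapMaybe isInj₂

lefts-++ : ∀ (xs ys : List (A ⊎ C)) → lefts (xs ++ ys) ≡ lefts xs ++ lefts ys
lefts-++ []            ys = refl
lefts-++ (inj₁ x ∷ xs) ys = cong (x ∷_) (lefts-++ xs ys)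
lefts-++ (inj₂ _ ∷ xs) ys = lefts-++ xs ys

rights-++ : ∀ (xs ys : List (A ⊎ C)) → rights (xs ++ ys) ≡ rights xs ++ rights ys
rights-++ []            ys = refl
rights-++ (inj₁ _ ∷ xs) ys = rights-++ xs ys
rights-++ (inj₂ y ∷ xs) ys = cong (y ∷_) (rights-++ xs ys)

lefts-map : ∀ (xs : List A) (ys : List C) → lefts (map inj₁ xs ++ map inj₂ ys) ≡ xs
lefts-map []       []       = refl
lefts-map []       (y ∷ ys) = lefts-map [] ys
lefts-map (x ∷ xs) ys       = cong (x ∷_) (lefts-map xs ys)

rights-map : ∀ (xs : List A) (ys : List C) → rights (map inj₁ xs ++ map inj₂ ys) ≡ ys
rights-map []       []       = refl
rights-map []       (y ∷ ys) = cong (y ∷_) (rights-map [] ys)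
rights-map (x ∷ xs) ys       = rights-map xs ys

interchange : ∀ (ws xs ys zs : List A) → (ws ++ xs) ++ ys ++ zs ↭ (ws ++ ys) ++ xs ++ zs
interchange ws xs ys zs = begin
  (ws ++ xs) ++ ys ++ zs  ≡⟨ ++-assoc ws xs (ys ++ zs) ⟩
  ws ++ xs ++ ys ++ zs    ↭⟨ ++⁺ˡ ws (shifts xs ys) ⟩
  ws ++ ys ++ xs ++ zs    ≡⟨ ++-assoc ws ys (xs ++ zs) ⟨
  (ws ++ ys) ++ xs ++ zs  ∎
  where open PermutationReasoning

copies-++ : ∀ k (xs ys : List A) → copies k (xs ++ ys) ↭ copies k xs ++ copies k ys
copies-++ zero    xs ys = refl
copies-++ (suc k) xs ys = ↭-trans (++⁺ˡ (xs ++ ys) (copies-++ k xs ys))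
  (interchange xs ys (copies k xs) (copies k ys))

copies-map : ∀ (f : A → C) k xs → copies k (map f xs) ≡ map f (copies k xs)
copies-map f zero    xs = refl
copies-map f (suc k) xs = trans (cong (map f xs ++_) (copies-map f k xs)) (sym (map-++ f xs _))

All-copies : ∀ {P : A → Set} k {xs} → All P xs → All P (copies k xs)
All-copies zero    all = []
All-copies (suc k) all = AllP.++⁺ all (All-copies k all)

Pointwise-∈-All : ∀ {P : A → Set} {ps xss} → Pointwise _∈_ ps xss → All P (concat xss) → All P ps
Pointwise-∈-All []                        all = []
Pointwise-∈-All (_∷_ {y = xs} p∈ ps∈) all =
  All.lookup (AllP.++⁻ˡ xs all) p∈ ∷ Pointwise-∈-All ps∈ (AllP.++⁻ʳ xs all)

Pointwise-++⁻ : ∀ {R : A → C → Set} {ps} xs {ys} → Pointwise R ps (xs ++ ys) →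
  ∃₂ λ qs rs → ps ≡ qs ++ rs × Pointwise R qs xs × Pointwise R rs ys
Pointwise-++⁻ []       r       = [] , _ , refl , [] , r
Pointwise-++⁻ (x ∷ xs) (r ∷ rs) with Pointwise-++⁻ xs rs
... | qs , ts , refl , rq , rt = _ ∷ qs , ts , refl , r ∷ rq , rt

++-↭-separate : ∀ {P : A → Set} → Decidable P → ∀ {ws xs ys zs} →
  All P ws → All (¬_ ∘ P) xs → All P ys → All (¬_ ∘ P) zs →
  ws ++ xs ↭ ys ++ zs → ws ↭ ys × xs ↭ zs
++-↭-separate {P = P} P? {ws} {xs} {ys} {zs} pw px py pz p =
    subst₂ _↭_ (onlyP pw px) (onlyP py pz) (filter-↭ P? p)
  , subst₂ _↭_ (only¬P pw px) (only¬P py pz) (filter-↭ (∁? P?) p)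
  where
  onlyP : ∀ {as bs} → All P as → All (¬_ ∘ P) bs → filter P? (as ++ bs) ≡ as
  onlyP {as} {bs} pa pb = trans (filter-++ P? as bs)
    (trans (cong₂ _++_ (filter-all P? pa) (filter-none P? pb)) (++-identityʳ as))
  only¬P : ∀ {as bs} → All P as → All (¬_ ∘ P) bs → filter (∁? P?) (as ++ bs) ≡ bs
  only¬P {as} {bs} pa pb = trans (filter-++ (∁? P?) as bs)
    (cong₂ _++_ (filter-none (∁? P?) (All.map (λ q ¬q → ¬q q) pa)) (filter-all (∁? P?) pb))

-- Splitting one vertex off another

module SplittingOff (G : Graph) (u u′ : Graph.V G) (k : ℕ) where
  open Graph G
  open Walks G

  -- A way to move one unit of weight from u (of weight 2 + k) to u′ within the
  -- edges E, leaving the choice of the edge ends to be moved open.  The ends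
  -- are picked one from each row; the labels stand for picks that move nothing.
  record Splitting (L : ℕ → Set) (E : Edges) {Piece : Set} (edges : Piece → Edges) : Set where
    field
      rows       : List (List (V ⊎ ℕ))
      neighbours : List V
      inside     : Edges
      labels     : List ℕ
      lengths    : All (λ r → length r ≡ 2 + k) rows
      labelled   : All L labels
      E≅         : E ≅ star u neighbours ++ inside
      away       : ∀ b → countEdge G u b inside ≡ 0
      -- The labels are (2 + k)-fold already within one piece. The neighbours become so only when
      -- all pieces are taken together, so no factor stands before them here.
      rows↭      : concat rows ↭ map inj₁ neighbours ++ copies (2 + k) (map inj₂ labels)
      reattach   : ∀ {ps} → Pointwise _∈_ ps rows → rights ps ↭ labels →
        ∃₂ λ (p : Piece) kept → neighbours ↭ lefts ps ++ kept ×
          edges p ≅ star u′ (lefts ps) ++ star u kept ++ inside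

    picks-labelled : ∀ {ps} → Pointwise _∈_ ps rows → All L (rights ps)
    picks-labelled ps∈ = labels-only (Pointwise-∈-All ps∈
      (All-resp-↭ (↭-sym rows↭) (AllP.++⁺ (AllP.map⁺ (All.universal (λ _ → tt) neighbours))
        (All-copies (2 + k) (AllP.map⁺ labelled)))))
      where
      Ok : V ⊎ ℕ → Set
      Ok (inj₁ _) = ⊤
      Ok (inj₂ l) = L l
      labels-only : ∀ {qs} → All Ok qs → All L (rights qs)
      labels-only []                  = []
      labels-only {inj₁ _ ∷ _} (_ ∷ a) = labels-only a
      labels-only {inj₂ _ ∷ _} (l ∷ a) = l ∷ labels-only a

  unaffected : ∀ {L E} {Piece : Set} {edges : Piece → Edges} (p : Piece) → E ≅ edges p →
    (∀ b → countEdge G u b E ≡ 0) → Splitting L E edges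
  unaffected {E = E} p E≅p away = record
    { rows = [] ; neighbours = [] ; inside = E ; labels = [] ; lengths = [] ; labelled = []
    ; E≅ = ≅-refl ; away = away ; rows↭ = ↭-reflexive (sym (copies-[] (2 + k)))
    ; reattach = λ { [] _ → p , [] , refl , ≅-sym E≅p } }

  transport : ∀ {L E} {P Q : Set} {edgesP : P → Edges} {edgesQ : Q → Edges} (f : P → Q) →
    (∀ p → edgesP p ≡ edgesQ (f p)) → Splitting L E edgesP → Splitting L E edgesQ
  transport f f-edges S = record
    { rows = rows ; neighbours = neighbours ; inside = inside ; labels = labels ; lengths = lengths
    ; labelled = labelled ; E≅ = E≅ ; away = away ; rows↭ = rows↭
    ; reattach = λ ps∈ rights↭ → let p , kept , N , e = reattach ps∈ rights↭ in
        f p , kept , N , subst (_≅ _) (f-edges p) e }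
    where open Splitting S

  -- A selection is known only for the rows of all pieces at once. Since the first piece owns the
  -- label `g` and the later ones only larger labels, sorting the picks by label shows that each
  -- piece received exactly its own, which for a closed walk fixes the number of trails left alone.
  combine : ∀ {g E F} {P Q : Set} {edgesP : P → Edges} {edgesQ : Q → Edges} →
    Splitting (_≡ g) E edgesP → Splitting (suc g ≤_) F edgesQ →
    Splitting (g ≤_) (E ++ F) {P × Q} (λ (p , q) → edgesP p ++ edgesQ q)
  combine {g} {E} {F} S T = record
    { rows = S.rows ++ T.rows ; neighbours = S.neighbours ++ T.neighbours
    ; inside = S.inside ++ T.inside ; labels = S.labels ++ T.labels
    ; lengths = AllP.++⁺ S.lengths T.lengths
    ; labelled = AllP.++⁺ (All.map (λ eq → ≤-reflexive (sym eq)) S.labelled) (All.map <⇒≤ T.labelled)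
    ; E≅ = ≅-trans (≅-++ S.E≅ T.E≅) (↭⇒≅ (↭-trans
        (interchange (star u S.neighbours) S.inside (star u T.neighbours) T.inside)
        (↭-reflexive (cong (_++ (S.inside ++ T.inside)) (sym (map-++ (u ,_) S.neighbours T.neighbours))))))
    ; away = λ b → trans (countEdge-++ u b S.inside T.inside) (cong₂ _+_ (S.away b) (T.away b))
    ; rows↭ = begin
        concat (S.rows ++ T.rows)          ≡⟨ concat-++ S.rows T.rows ⟨
        concat S.rows ++ concat T.rows     ↭⟨ ++⁺ S.rows↭ T.rows↭ ⟩
        (map inj₁ S.neighbours ++ c S.labels) ++ map inj₁ T.neighbours ++ c T.labels
          ↭⟨ interchange (map inj₁ S.neighbours) (c S.labels) (map inj₁ T.neighbours) (c T.labels) ⟩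
        (map inj₁ S.neighbours ++ map inj₁ T.neighbours) ++ c S.labels ++ c T.labels
          ≡⟨ cong (_++ (c S.labels ++ c T.labels)) (map-++ inj₁ S.neighbours T.neighbours) ⟨
        map inj₁ (S.neighbours ++ T.neighbours) ++ c S.labels ++ c T.labels
          ↭⟨ ++⁺ˡ (map inj₁ (S.neighbours ++ T.neighbours)) (↭-sym (copies-++ (2 + k) (map inj₂ S.labels) (map inj₂ T.labels))) ⟩
        map inj₁ (S.neighbours ++ T.neighbours) ++ copies (2 + k) (map inj₂ S.labels ++ map inj₂ T.labels)
          ≡⟨ cong (λ l → map inj₁ (S.neighbours ++ T.neighbours) ++ copies (2 + k) l)
               (map-++ inj₂ S.labels T.labels) ⟨
        map inj₁ (S.neighbours ++ T.neighbours) ++ c (S.labels ++ T.labels) ∎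
    ; reattach = reattach
    }
    where
    module S = Splitting S
    module T = Splitting T
    open PermutationReasoning
    c : List ℕ → List (V ⊎ ℕ)
    c l = copies (2 + k) (map inj₂ l)
    later : ∀ {ls} → All (suc g ≤_) ls → All (λ l → l ≢ g) ls
    later = All.map λ g<l l≡g → <⇒≢ g<l (sym l≡g)
    reattach : ∀ {ps} → Pointwise _∈_ ps (S.rows ++ T.rows) → rights ps ↭ S.labels ++ T.labels → _
    reattach ps∈ rights↭ with Pointwise-++⁻ S.rows ps∈
    ... | qs , rs , refl , qs∈ , rs∈ =
      let rights-q , rights-r = ++-↭-separate (Data.Nat._≟ g) (S.picks-labelled qs∈) (later (T.picks-labelled rs∈))
            S.labelled (later T.labelled) (subst (_↭ _) (rights-++ qs rs) rights↭)
          p , kept₁ , N₁ , E₁ = S.reattach qs∈ rights-q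
          q , kept₂ , N₂ , E₂ = T.reattach rs∈ rights-r
      in (p , q) , kept₁ ++ kept₂
        , subst (λ l → _ ↭ l ++ kept₁ ++ kept₂) (sym (lefts-++ qs rs))
            (↭-trans (++⁺ N₁ N₂)
              (interchange (lefts qs) kept₁ (lefts rs) kept₂))
        , ≅-trans (≅-++ E₁ E₂) (↭⇒≅ (begin
            (star u′ (lefts qs) ++ star u kept₁ ++ S.inside) ++ star u′ (lefts rs) ++ star u kept₂ ++ T.inside
              ↭⟨ interchange (star u′ (lefts qs)) (star u kept₁ ++ S.inside) (star u′ (lefts rs)) _ ⟩
            (star u′ (lefts qs) ++ star u′ (lefts rs)) ++ (star u kept₁ ++ S.inside) ++ star u kept₂ ++ T.inside
              ↭⟨ ++⁺ˡ (star u′ (lefts qs) ++ star u′ (lefts rs))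
                   (interchange (star u kept₁) S.inside (star u kept₂) T.inside) ⟩
            (star u′ (lefts qs) ++ star u′ (lefts rs)) ++ (star u kept₁ ++ star u kept₂) ++ S.inside ++ T.inside
              ≡⟨ cong₂ (λ l m → l ++ m ++ S.inside ++ T.inside)
                   (trans (cong (star u′) (lefts-++ qs rs)) (map-++ (u′ ,_) (lefts qs) (lefts rs)))
                   (map-++ (u ,_) kept₁ kept₂) ⟨
            star u′ (lefts (qs ++ rs)) ++ star u (kept₁ ++ kept₂) ++ S.inside ++ T.inside ∎))

-- Moving one unit of weight within a closed walk or within the 1-factor

module Pieces (G : Graph) (u u′ : Graph.V G) (k : ℕ) where
  open Graph G
  open Walks G
  open SplittingOff G u u′ k

  -- A walk from u back to u, kept in a form that can be traversed both ways.
  record Trail : Set where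
    field
      path      : List V
      source target : V
      interior  : Edges
      -- The quantified ends allow `u` to be replaced by `u′` at either end: only the edges at
      -- `source` and `target` see the change.
      links≅    : ∀ x y → links x path y ≅ (x , source) ∷ (y , target) ∷ interior
      avoids    : ∀ b → countEdge G u b interior ≡ 0
  open Trail

  opposite : Trail → Trail
  opposite τ = record
    { path = reverse (path τ) ; source = target τ ; target = source τ ; interior = interior τ
    ; links≅ = λ x y → ≅-trans (links-reverse x (path τ) y) (≅-trans (links≅ τ y x) (↭⇒≅ (swap _ _ refl)))
    ; avoids = avoids τ }

  -- An empty trail would be a loop at `u`. A trail with one inner vertex has it as source and as
  -- target, with two parallel edges to `u`.
  trail : ∀ t → u ∉ t → countEdge G u u (links u t u) ≡ 0 → ∃ λ τ → path τ ≡ t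
  trail []       u∉t loopless = contradiction loopless (countEdge-∈ {es = (u , u) ∷ []} (here refl))
  trail (z ∷ zs) u∉t _ = record
    { path = z ∷ zs ; source = z ; target = final z zs ; interior = inner z zs
    ; links≅ = λ x y → ≅-∷ (x , z) (links-inner z zs y)
    ; avoids = countEdge-∉ (inner z zs) (inner-∉ z zs u∉t) } , refl
    where
    final : V → List V → V
    final z []       = z
    final z (w ∷ ws) = final w ws
    inner : V → List V → Edges
    inner z []       = []
    inner z (w ∷ ws) = (z , w) ∷ inner w ws
    links-inner : ∀ z zs y → links z zs y ≅ (y , final z zs) ∷ inner z zs
    links-inner z []       y = flip-≅ z y
    links-inner z (w ∷ ws) y = ≅-trans (≅-∷ (z , w) (links-inner w ws y)) (↭⇒≅ (swap _ _ refl))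
    inner-∉ : ∀ z zs → u ∉ z ∷ zs → u ∉ endpoints (inner z zs)
    inner-∉ z (w ∷ ws) u∉ (here u≡z)         = u∉ (here u≡z)
    inner-∉ z (w ∷ ws) u∉ (there (here u≡w)) = u∉ (there (here u≡w))
    inner-∉ z (w ∷ ws) u∉ (there (there p))  = inner-∉ w ws (λ q → u∉ (there q)) p

  trails : ∀ ts → All (u ∉_) ts → countEdge G u u (petals u ts) ≡ 0 → ∃ λ τs → map path τs ≡ ts
  trails []       []         _        = [] , refl
  trails (t ∷ ts) (u∉t ∷ u∉) loopless =
    let eq = trans (sym (countEdge-++ u u (links u t u) (petals u ts))) loopless
        τ , p  = trail t u∉t (m+n≡0⇒m≡0 _ eq)
        τs , q = trails ts u∉ (m+n≡0⇒n≡0 (countEdge G u u (links u t u)) eq)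
    in τ ∷ τs , cong₂ _∷_ p q

  ends : Trail → List V
  ends τ = source τ ∷ target τ ∷ []

  petals-trails : ∀ τs → petals u (map path τs) ≅ star u (concatMap ends τs) ++ concatMap interior τs
  petals-trails []       = ≅-refl
  petals-trails (τ ∷ τs) = ≅-trans (≅-++ (links≅ τ u u) (petals-trails τs))
    (↭⇒≅ (interchange (star u (ends τ)) (interior τ) (star u (concatMap ends τs)) (concatMap interior τs)))

  -- With K = 2 + k there are 2 + (K - 2) entries, the length that regularity demands. The pick
  -- `inj₂ g` leaves the trail as it is.
  row : ℕ → Trail → List (V ⊎ ℕ)
  row g τ = inj₁ (source τ) ∷ inj₁ (target τ) ∷ replicate k (inj₂ g)

  concat-row : ∀ g τs → concatMap (row g) τs ↭
    map inj₁ (concatMap ends τs) ++ copies (length τs) (map inj₂ (replicate k g))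
  concat-row g []       = refl
  concat-row g (τ ∷ τs) = ↭-trans
    (++⁺ (↭-reflexive (cong (λ l → map inj₁ (ends τ) ++ l) (sym (map-replicate inj₂ k g)))) (concat-row g τs))
    (interchange (map inj₁ (ends τ)) (map inj₂ (replicate k g)) (map inj₁ (concatMap ends τs)) _)

  record Decoded (ps : List (V ⊎ ℕ)) (τs : List Trail) : Set where
    field
      kept moved : List Trail
      lefts≡     : lefts ps ≡ map source moved
      |rights|   : length (rights ps) ≡ length kept
      |kept+moved|       : length τs ≡ length moved + length kept
      ends↭      : concatMap ends τs ↭ map source moved ++ map target moved ++ concatMap ends kept
      interior↭  : concatMap interior τs ↭ concatMap interior moved ++ concatMap interior kept
      path↭      : concatMap path τs ↭ concatMap path moved ++ concatMap path kept

  -- A trail picked at its target is stored reversed, so that the moved end of every moved trail is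
  -- its `source`.
  decode : ∀ g τs {ps} → Pointwise _∈_ ps (map (row g) τs) → Decoded ps τs
  decode g [] [] = record { kept = [] ; moved = [] ; lefts≡ = refl ; |rights| = refl ; |kept+moved| = refl
                          ; ends↭ = refl ; interior↭ = refl ; path↭ = refl }
  decode g (τ ∷ τs) {p ∷ ps} (p∈ ∷ ps∈) = step p∈
    where
    open Decoded (decode g τs ps∈)
    move : ∀ σ → ends τ ↭ ends σ → interior τ ≡ interior σ → path τ ↭ path σ →
      p ≡ inj₁ (source σ) → Decoded (p ∷ ps) (τ ∷ τs)
    move σ e i q refl = record
      { kept = kept ; moved = σ ∷ moved
      ; lefts≡ = cong (source σ ∷_) lefts≡ ; |rights| = |rights| ; |kept+moved| = cong suc |kept+moved|
      ; ends↭ = ↭-trans (++⁺ e ends↭) (prep (source σ)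
          (↭-sym (shift (target σ) (map source moved) _)))
      ; interior↭ = ↭-trans (++⁺ (↭-reflexive i) interior↭)
          (↭-reflexive (sym (++-assoc (interior σ) _ _)))
      ; path↭ = ↭-trans (++⁺ q path↭) (↭-reflexive (sym (++-assoc (path σ) _ _))) }
    keep : p ≡ inj₂ g → Decoded (p ∷ ps) (τ ∷ τs)
    keep refl = record
      { kept = τ ∷ kept ; moved = moved
      ; lefts≡ = lefts≡ ; |rights| = cong suc |rights|
      ; |kept+moved| = trans (cong suc |kept+moved|) (sym (+-suc (length moved) (length kept)))
      ; ends↭ = ↭-trans (++⁺ˡ (ends τ) ends↭) (↭-trans (shifts (ends τ) (map source moved))
          (++⁺ˡ (map source moved) (shifts (ends τ) (map target moved))))
      ; interior↭ = ↭-trans (++⁺ˡ (interior τ) interior↭) (shifts (interior τ) (concatMap interior moved))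
      ; path↭ = ↭-trans (++⁺ˡ (path τ) path↭) (shifts (path τ) (concatMap path moved)) }
    step : p ∈ row g τ → Decoded (p ∷ ps) (τ ∷ τs)
    step (here eq)         = move τ refl refl refl eq
    step (there (here eq)) = move (opposite τ) (swap _ _ refl) refl (↭-sym (↭-reverse (path τ))) eq
    step (there (there q)) = keep (All.lookup {P = _≡ inj₂ g} (AllP.replicate⁺ k refl) q)

  closedWalk : ∀ g {R W} w → u ∉ R → w ↭ replicate (2 + k) u ++ R →
    u′ ∷ replicate (1 + k) u ++ R ↭ W → countEdge G u u (cycEdges G w) ≡ 0 →
    Splitting (_≡ g) (cycEdges G w) {∃ λ w′ → w′ ↭ W} (λ (w′ , _) → cycEdges G w′)
  closedWalk g {R} {W} w u∉R w↭ ↭W loopless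
    with ∈-∃++ (∈-resp-↭ (↭-sym w↭) (here refl))
  ... | xs , ys , refl with cut u (ys ++ xs)
  ...   | t , ts , eq , u∉ts with trails (t ∷ ts) u∉ts (trans (sym (at around u u)) loopless)
    where
    around : cycEdges G (xs ++ u ∷ ys) ≅ petals u (t ∷ ts)
    around = ≅-trans (cycEdges-rotate xs u ys) (≅-reflexive
      (trans (cong (λ l → links u l u) eq) (links-closed u t ts)))
  ...     | τs , paths≡ = record
    { rows = map (row g) τs ; neighbours = concatMap ends τs ; inside = concatMap interior τs
    ; labels = replicate k g
    ; lengths = AllP.map⁺ (All.universal (λ τ → cong (2 +_) (length-replicate k)) τs)
    ; labelled = AllP.replicate⁺ k refl
    ; E≅ = ≅-trans (cycEdges-rotate xs u ys) (≅-trans (≅-reflexive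
        (trans (cong (λ l → links u l u) eq) (trans (links-closed u t ts) (cong (petals u) (sym paths≡)))))
        (petals-trails τs))
    ; away = interiors-away τs
    -- There are K = 2 + k trails, so k labels in each row amount to K copies of `labels`. A perfect
    -- matching then picks `g` exactly k times and moves an end of each of the two other trails.
    ; rows↭ = subst (λ n → concatMap (row g) τs ↭ map inj₁ (concatMap ends τs) ++ copies n (map inj₂ (replicate k g)))
        |τs| (concat-row g τs)
    ; reattach = reattach
    }
    where
    interiors-away : ∀ τs b → countEdge G u b (concatMap interior τs) ≡ 0
    interiors-away []       b = refl
    interiors-away (τ ∷ τs) b = trans (countEdge-++ u b (interior τ) _)
      (cong₂ _+_ (avoids τ b) (interiors-away τs b))
    -- Each trail accounts for one visit to `u`, and `R` contains none.
    counted : length (t ∷ ts) ≡ 2 + k × concat (t ∷ ts) ↭ R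
    counted = replicate-++-cancel (length (t ∷ ts)) (2 + k) (concat-∉ u∉ts) u∉R
      (↭-trans (↭-sym (concatMap-∷-↭ u (t ∷ ts)))
        (↭-trans (↭-reflexive (cong (u ∷_) (sym eq)))
        (↭-trans (prep u (++-comm-↭ ys xs)) (↭-trans (↭-sym (shift u xs ys)) w↭))))
    |τs| : length τs ≡ 2 + k
    |τs| = trans (sym (length-map path τs)) (trans (cong length paths≡) (proj₁ counted))
    τs↭R : concatMap path τs ↭ R
    τs↭R = ↭-trans (↭-reflexive (cong concat paths≡)) (proj₂ counted)
    reattach : ∀ {ps} → Pointwise _∈_ ps (map (row g) τs) → rights ps ↭ replicate k g → _
    reattach {ps} ps∈ rights↭ = rebuild moved (lefts ps) |moved| lefts≡ ends↭ interior↭ path↭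
      where
      open Decoded (decode g τs ps∈)
      |kept| : length kept ≡ k
      |kept| = trans (sym |rights|) (trans (↭-length rights↭) (length-replicate k))
      |moved| : length moved ≡ 2
      |moved| = +-cancelʳ-≡ k _ _ (trans (cong (length moved +_) (sym |kept|)) (trans (sym |kept+moved|) |τs|))
      rebuild : ∀ moved ls → length moved ≡ 2 → ls ≡ map source moved →
        concatMap ends τs ↭ map source moved ++ map target moved ++ concatMap ends kept →
        concatMap interior τs ↭ concatMap interior moved ++ concatMap interior kept →
        concatMap path τs ↭ concatMap path moved ++ concatMap path kept →
        ∃₂ λ (p : ∃ λ w′ → w′ ↭ W) N → concatMap ends τs ↭ ls ++ N ×
          cycEdges G (proj₁ p) ≅ star u′ ls ++ star u N ++ concatMap interior τs
      rebuild (σ ∷ ρ ∷ []) _ _ refl e i q =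
        (w′ , w′↭) , target σ ∷ target ρ ∷ concatMap ends kept , e , w′≅
        where
        -- `u` stands before each of the k kept trails and once before `ρ`, thus 1 + k times. As `ρ`
        -- is run backwards, the two neighbours of `u′` are the sources of `σ` and `ρ`, the picked
        -- ends.
        w′ = u′ ∷ path σ ++ concatMap (u ∷_) (map path kept) ++ u ∷ reverse (path ρ)
        w′↭ : w′ ↭ W
        w′↭ = ↭-trans (prep u′ (begin
          path σ ++ concatMap (u ∷_) (map path kept) ++ u ∷ reverse (path ρ)
            ↭⟨ ++⁺ˡ (path σ) (++⁺ (concatMap-∷-↭ u (map path kept)) (prep u (↭-reverse (path ρ)))) ⟩
          path σ ++ (replicate (length (map path kept)) u ++ concatMap path kept) ++ u ∷ path ρ
            ≡⟨ cong (λ n → path σ ++ (replicate n u ++ concatMap path kept) ++ u ∷ path ρ)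
                 (trans (length-map path kept) |kept|) ⟩
          path σ ++ (replicate k u ++ concatMap path kept) ++ u ∷ path ρ
            ≡⟨ cong (path σ ++_) (++-assoc (replicate k u) _ _) ⟩
          path σ ++ replicate k u ++ concatMap path kept ++ u ∷ path ρ
            ↭⟨ shifts (path σ) (replicate k u) ⟩
          replicate k u ++ path σ ++ concatMap path kept ++ u ∷ path ρ
            ↭⟨ ++⁺ˡ (replicate k u) (++⁺ˡ (path σ) (++-comm-↭ (concatMap path kept) (u ∷ path ρ))) ⟩
          replicate k u ++ path σ ++ u ∷ path ρ ++ concatMap path kept
            ↭⟨ ++⁺ˡ (replicate k u) (shift u (path σ) _) ⟩
          replicate k u ++ u ∷ path σ ++ path ρ ++ concatMap path kept
            ↭⟨ shift u (replicate k u) _ ⟩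
          u ∷ replicate k u ++ path σ ++ path ρ ++ concatMap path kept
            ≡⟨ cong (λ l → u ∷ replicate k u ++ path σ ++ l ++ concatMap path kept) (++-identityʳ (path ρ)) ⟨
          u ∷ replicate k u ++ path σ ++ (path ρ ++ []) ++ concatMap path kept
            ≡⟨ cong (λ l → u ∷ replicate k u ++ l) (++-assoc (path σ) _ _) ⟨
          u ∷ replicate k u ++ concatMap path (σ ∷ ρ ∷ []) ++ concatMap path kept
            ↭⟨ ++⁺ˡ (replicate (1 + k) u) q ⟨
          u ∷ replicate k u ++ concatMap path τs
            ↭⟨ ++⁺ˡ (replicate (1 + k) u) τs↭R ⟩
          u ∷ replicate k u ++ R ∎)) ↭W
          where open PermutationReasoning
        w′≅ : cycEdges G w′ ≅ star u′ (source σ ∷ source ρ ∷ []) ++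
          star u (target σ ∷ target ρ ∷ concatMap ends kept) ++ concatMap interior τs
        w′≅ = begin
          cycEdges G w′
            ≡⟨ trans (cycEdges-links u′ _) (links-petals u′ (path σ) u (map path kept) (reverse (path ρ)) u′) ⟩
          links u′ (path σ) u ++ petals u (map path kept) ++ links u (reverse (path ρ)) u′
            ≈⟨ ≅-++ (links≅ σ u′ u) (≅-++ (petals-trails kept)
                 (≅-trans (links-reverse u (path ρ) u′) (links≅ ρ u′ u))) ⟩
          (u′ , source σ) ∷ (u , target σ) ∷ interior σ ++
            (star u (concatMap ends kept) ++ concatMap interior kept) ++
            (u′ , source ρ) ∷ (u , target ρ) ∷ interior ρ
            ≈⟨ ↭⇒≅ (ES.solve 8 (λ a b c d e f g h →
                 a ES.⊕ (b ES.⊕ (c ES.⊕ ((d ES.⊕ e) ES.⊕ (f ES.⊕ (g ES.⊕ h)))))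
                 ES.⊜ a ES.⊕ (f ES.⊕ (b ES.⊕ (g ES.⊕ (d ES.⊕ ((c ES.⊕ (h ES.⊕ ES.id)) ES.⊕ e)))))) refl
                 ((u′ , source σ) ∷ []) ((u , target σ) ∷ []) (interior σ)
                 (star u (concatMap ends kept)) (concatMap interior kept)
                 ((u′ , source ρ) ∷ []) ((u , target ρ) ∷ []) (interior ρ)) ⟩
          star u′ (source σ ∷ source ρ ∷ []) ++ star u (target σ ∷ target ρ ∷ concatMap ends kept) ++
            concatMap interior (σ ∷ ρ ∷ []) ++ concatMap interior kept
            ≈⟨ ≅-++ {star u′ (source σ ∷ source ρ ∷ [])} ≅-refl
                 (≅-++ {star u (target σ ∷ target ρ ∷ concatMap ends kept)} ≅-refl (↭⇒≅ (↭-sym i))) ⟩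
          star u′ (source σ ∷ source ρ ∷ []) ++ star u (target σ ∷ target ρ ∷ concatMap ends kept) ++
            concatMap interior τs ∎
          where
          open ≅-Reasoning
          module ES = EdgeSolver
      rebuild []              _ ()
      rebuild (_ ∷ [])        _ ()
      rebuild (_ ∷ _ ∷ _ ∷ _) _ ()

  -- Edges at `u` are turned to start there. Without loops each of them holds `u` exactly once, so
  -- the number of neighbours is the number of occurrences of `u` among the endpoints.
  gather : ∀ es → countEdge G u u es ≡ 0 → ∃₂ λ N rest → es ≅ star u N ++ rest ×
    endpoints es ↭ replicate (length N) u ++ N ++ endpoints rest × u ∉ N × u ∉ endpoints rest
  gather []             _ = [] , [] , ≅-refl , refl , (λ ()) , (λ ())
  gather ((a , b) ∷ es) loopless
    with gather es (m+n≡0⇒n≡0 (countEdge G u u ((a , b) ∷ [])) (trans (sym (countEdge-++ u u ((a , b) ∷ []) es)) loopless))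
       | a ≟V u | b ≟V u
  ... | N , rest , e , p , u∉N , u∉r | yes refl | b? = b ∷ N , rest , ≅-∷ (u , b) e
    , ↭-trans (prep u (prep b p)) (prep u (↭-sym (shift b (replicate (length N) u) _)))
    , (λ { (here refl) → countEdge-∈ {es = (u , u) ∷ es} (here refl) loopless ; (there q) → u∉N q }) , u∉r
  ... | N , rest , e , p , u∉N , u∉r | no a≢u | yes refl = a ∷ N , rest
    , ≅-++ {(a , u) ∷ []} {(u , a) ∷ []} (flip-≅ a u) e
    , ↭-trans (swap a u p) (prep u (↭-sym (shift a (replicate (length N) u) _)))
    , (λ { (here u≡a) → a≢u (sym u≡a) ; (there q) → u∉N q }) , u∉r
  ... | N , rest , e , p , u∉N , u∉r | no a≢u | no b≢u = N , (a , b) ∷ rest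
    , ≅-trans (≅-∷ (a , b) e) (↭⇒≅ (↭-sym (shift (a , b) (star u N) rest)))
    , ↭-trans (++⁺ˡ (a ∷ b ∷ []) p) (↭-trans (shifts (a ∷ b ∷ []) (replicate (length N) u))
        (++⁺ˡ (replicate (length N) u) (shifts (a ∷ b ∷ []) N)))
    , u∉N
    , λ { (here u≡a) → a≢u (sym u≡a) ; (there (here u≡b)) → b≢u (sym u≡b) ; (there (there q)) → u∉r q }

  -- A 1-factor has no connectedness to preserve, so a single row is enough: the K edges at `u`
  -- supply its K entries without dummies, and the one picked moves to `u′`.
  matching : ∀ {L R W} es → u ∉ R → endpoints es ↭ replicate (2 + k) u ++ R →
    u′ ∷ replicate (1 + k) u ++ R ↭ W → countEdge G u u es ≡ 0 →
    Splitting L es {∃ λ es′ → endpoints es′ ↭ W} proj₁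
  matching {L} {R} {W} es u∉R es↭ ↭W loopless with gather es loopless
  ... | N , rest , es≅ , ends↭ , u∉N , u∉rest = record
    { rows = map inj₁ N ∷ [] ; neighbours = N ; inside = rest ; labels = []
    ; lengths = trans (length-map inj₁ N) (proj₁ counted) ∷ [] ; labelled = []
    ; E≅ = es≅ ; away = countEdge-∉ rest u∉rest
    ; rows↭ = ↭-reflexive (cong (map inj₁ N ++_) (sym (copies-[] (2 + k))))
    ; reattach = reattach
    }
    where
    counted : length N ≡ 2 + k × N ++ endpoints rest ↭ R
    counted = replicate-++-cancel (length N) (2 + k) (λ u∈ → case ∈-++⁻ N u∈ of λ where
        (inj₁ p) → u∉N p
        (inj₂ p) → u∉rest p)
      u∉R (↭-trans (↭-sym ends↭) es↭)
    endpoints-star : ∀ ns → endpoints (star u ns ++ rest) ↭ replicate (length ns) u ++ ns ++ endpoints rest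
    endpoints-star []       = refl
    endpoints-star (n ∷ ns) = prep u (↭-trans (prep n (endpoints-star ns))
      (↭-sym (shift n (replicate (length ns) u) _)))
    reattach : ∀ {ps} → Pointwise _∈_ ps (map inj₁ N ∷ []) → rights ps ↭ [] → _
    reattach (p∈ ∷ []) _ with ∈-map⁻ inj₁ p∈
    ... | q , q∈N , refl with ∈⇒↭∷ q∈N
    ...   | N′ , N↭ = ((u′ , q) ∷ star u N′ ++ rest , ↭-trans (prep u′ (begin
        q ∷ endpoints (star u N′ ++ rest)                     ↭⟨ prep q (endpoints-star N′) ⟩
        q ∷ replicate (length N′) u ++ N′ ++ endpoints rest   ↭⟨ shift q (replicate (length N′) u) _ ⟨
        replicate (length N′) u ++ q ∷ N′ ++ endpoints rest   ↭⟨ ++⁺ˡ (replicate (length N′) u) (++⁺ʳ (endpoints rest) (↭-sym N↭)) ⟩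
        replicate (length N′) u ++ N ++ endpoints rest        ↭⟨ ++⁺ˡ (replicate (length N′) u) (proj₂ counted) ⟩
        replicate (length N′) u ++ R                          ≡⟨ cong (λ n → replicate n u ++ R) |N′| ⟩
        replicate (1 + k) u ++ R                              ∎)) ↭W)
      , N′ , N↭ , ≅-refl
      where
      open PermutationReasoning
      |N′| : length N′ ≡ 1 + k
      |N′| = suc-injective (trans (sym (↭-length N↭)) (proj₁ counted))

-- Lists without repetition and prescribed multiplicities

Unique-resp-↭ : ∀ {xs ys : List A} → xs ↭ ys → Unique xs → Unique ys
Unique-resp-↭ p = PermutationSetoid.Unique-resp-↭ (setoid _) (↭⇒↭ₛ p)

Unique-++⁻ˡ : ∀ (xs : List A) {ys} → Unique (xs ++ ys) → Unique xs
Unique-++⁻ˡ []       _           = []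
Unique-++⁻ˡ (x ∷ xs) (x≢ ∷ uniq) = AllP.++⁻ˡ xs x≢ ∷ Unique-++⁻ˡ xs uniq

concatMap-↭ : ∀ (f : A → List C) {xs ys} → xs ↭ ys → concatMap f xs ↭ concatMap f ys
concatMap-↭ f p = concat-↭ (map⁺ f p)

module CountUnique {A : Set} (_≟_ : DecidableEquality A) where
  open Counting _≟_

  count-unique : ∀ {x xs} → Unique xs → x ∈ xs → count x xs ≡ 1
  count-unique {x} {y ∷ xs} uniq (here refl) = trans (count-++ x (x ∷ []) xs)
    (cong₂ _+_ (count-refl x) (count-∉ (Unique[x∷xs]⇒x∉xs uniq)))
  count-unique {x} {y ∷ xs} (y≢ ∷ uniq) (there x∈) = trans (count-++ x (y ∷ []) xs)
    (cong₂ _+_ (count-≢ λ x≡y → All.lookup y≢ x∈ (sym x≡y)) (count-unique uniq x∈))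

  count-replicate-≢ : ∀ {x y} n → x ≢ y → count x (replicate n y) ≡ 0
  count-replicate-≢ n x≢y = count-∉ λ x∈ → x≢y (All.lookup {P = _≡ _} (AllP.replicate⁺ n refl) x∈)

  count-multiples : ∀ (f : A → ℕ) {x xs} → Unique xs → x ∈ xs →
    count x (concatMap (λ y → replicate (f y) y) xs) ≡ f x
  count-multiples f {x} {y ∷ xs} uniq (here refl) = trans (count-++ x (replicate (f x) x) _)
    (trans (cong₂ _+_ (count-replicate x (f x)) (count-∉ λ x∈ → Unique[x∷xs]⇒x∉xs uniq (occurs x∈)))
      (+-identityʳ (f x)))
    where
    occurs : ∀ {z zs} → z ∈ concatMap (λ y → replicate (f y) y) zs → z ∈ zs
    occurs {zs = zs} z∈ = Any.map (λ {y} z∈y → All.lookup {P = _≡ y} (AllP.replicate⁺ (f y) refl) z∈y)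
      (∈-concatMap⁻ (λ y → replicate (f y) y) {xs = zs} z∈)
  count-multiples f {x} {y ∷ xs} (y≢ ∷ uniq) (there x∈) = trans (count-++ x (replicate (f y) y) _)
    (cong₂ _+_ (count-replicate-≢ (f y) λ x≡y → All.lookup y≢ x∈ (sym x≡y)) (count-multiples f uniq x∈))

-- Detachments of weighted multipartite graphs

data Kind : Set where
  cycle pairs : Kind

module Detachment (G : Graph) {I : Set} (_≟I_ : DecidableEquality I) (part : Graph.V G → I)
  (cross : I → I → ℕ) (cross-diagonal : ∀ i → cross i i ≡ 0) (cross-comm : ∀ i j → cross i j ≡ cross j i)
  (verts-unique : Unique (Graph.verts G)) (verts-complete : ∀ v → v ∈ Graph.verts G) where
  open Graph G
  open Walks G
  open Counting _≟V_
  open CountUnique _≟V_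

  -- A contents function lists the vertices of each part, each repeated as often
  -- as its weight, the number of vertices it still stands for.
  Contents : Set
  Contents = I → List V

  -- `c` lists the parts of one cycle, or of the whole 1-factor, of the original graph. Only the
  -- multiset of vertices is prescribed: reassembling a walk may change the order in which it passes
  -- through the parts, and the length is all that the type of a 2-factor records.
  Piece : Contents → Kind × List I → Set
  Piece B (cycle , c) = ∃ λ w → w ↭ concatMap B c
  Piece B (pairs , c) = ∃ λ es → endpoints es ↭ concatMap B c

  edges : ∀ {B} b → Piece B b → Edges
  edges (cycle , _) (w , _) = cycEdges G w
  edges (pairs , _) (es , _) = es

  allEdges : ∀ {B bs} → All (Piece B) bs → Edges
  allEdges []                = []
  allEdges {bs = b ∷ _} (p ∷ ps) = edges b p ++ allEdges ps

  -- It is 0 for a vertex that has not been split off yet.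
  weight : Contents → V → ℕ
  weight B v = count v (B (part v))

  Proper : Contents → Set
  Proper B = ∀ i → All (λ v → part v ≡ i) (B i)

  -- The case a = b is included; as `cross` vanishes on the diagonal, no piece has a loop or any
  -- edge inside a part.
  State : Contents → List (Kind × List I) → Set
  State B bs = ∃ λ (ps : All (Piece B) bs) → ∀ a b →
    countEdge G a b (allEdges ps) ≡ cross (part a) (part b) * (weight B a * weight B b)

  module _ {B B′ : Contents} {u u′ : V} {k : ℕ} {R : List V} (proper : Proper B)
    (part≡ : part u′ ≡ part u) (u′≢u : u′ ≢ u) (u∉R : u ∉ R) (u′∉R : u′ ∉ R)
    (before : B (part u) ↭ replicate (2 + k) u ++ R)
    (after  : B′ (part u) ↭ u′ ∷ replicate (1 + k) u ++ R)
    (others : ∀ j → j ≢ part u → B′ j ≡ B j) where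
    open SplittingOff G u u′ k
    open Pieces G u u′ k

    private
      i = part u

      concatMap-others : ∀ {c} → i ∉ c → concatMap B′ c ≡ concatMap B c
      concatMap-others {[]}    _  = refl
      concatMap-others {j ∷ c} i∉ = cong₂ _++_ (others j λ j≡i → i∉ (here (sym j≡i)))
        (concatMap-others λ i∈ → i∉ (there i∈))

      ∉-others : ∀ {c} → i ∉ c → u ∉ concatMap B c
      ∉-others {j ∷ c} i∉ u∈ with ∈-++⁻ (B j) u∈
      ... | inj₁ u∈j = i∉ (here (All.lookup (proper j) u∈j))
      ... | inj₂ u∈c = ∉-others (λ i∈ → i∉ (there i∈)) u∈c

      -- A base meets the part of `u` at most once, so a single block of its contents changes, and a
      -- piece that meets this part contains `u` with its full weight 2 + k.
      focus : ∀ {c} → Unique c → i ∈ c → ∃ λ R′ → u ∉ R′ ×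
        concatMap B c ↭ replicate (2 + k) u ++ R′ ×
        u′ ∷ replicate (1 + k) u ++ R′ ↭ concatMap B′ c
      focus {c} uniq i∈c with ∈⇒↭∷ i∈c
      ... | d , c↭ = R ++ concatMap B d
        , (λ u∈ → case ∈-++⁻ R u∈ of λ where
            (inj₁ p) → u∉R p
            (inj₂ p) → ∉-others i∉d p)
        , ↭-trans (concatMap-↭ B c↭) (↭-trans (++⁺ʳ (concatMap B d) before)
            (↭-reflexive (++-assoc (replicate (2 + k) u) R _)))
        , ↭-sym (↭-trans (concatMap-↭ B′ c↭) (↭-trans (++⁺ after (↭-reflexive (concatMap-others i∉d)))
            (↭-reflexive (cong (u′ ∷_) (++-assoc (replicate (1 + k) u) R _)))))
        where
        i∉d : i ∉ d
        i∉d = Unique[x∷xs]⇒x∉xs (Unique-resp-↭ c↭ uniq)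

      splitPiece : ∀ g b → Unique (proj₂ b) → (p : Piece B b) → countEdge G u u (edges b p) ≡ 0 →
        Splitting (_≡ g) (edges b p) {Piece B′ b} (edges b)
      splitPiece g (kind , c) uniq p loopless with Any.any? (i ≟I_) c
      splitPiece g (cycle , c) uniq (w , w↭) loopless | yes i∈c =
        let _ , u∉R′ , from , to = focus uniq i∈c
        in closedWalk g w u∉R′ (↭-trans w↭ from) to loopless
      splitPiece g (pairs , c) uniq (es , es↭) loopless | yes i∈c =
        let _ , u∉R′ , from , to = focus uniq i∈c
        in matching es u∉R′ (↭-trans es↭ from) to loopless
      splitPiece g (cycle , c) uniq (w , w↭) loopless | no i∉c = unaffected
        (w , subst (w ↭_) (sym (concatMap-others i∉c)) w↭) ≅-refl
        (cycEdges-∉ w λ u∈w → ∉-others i∉c (∈-resp-↭ w↭ u∈w))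
      splitPiece g (pairs , c) uniq (es , es↭) loopless | no i∉c = unaffected
        (es , subst (endpoints es ↭_) (sym (concatMap-others i∉c)) es↭) ≅-refl
        (countEdge-∉ es λ u∈ → ∉-others i∉c (∈-resp-↭ es↭ u∈))

      splitAll : ∀ g {bs} → All (Unique ∘ proj₂) bs → (ps : All (Piece B) bs) →
        countEdge G u u (allEdges ps) ≡ 0 → Splitting (g ≤_) (allEdges ps) {All (Piece B′) bs} allEdges
      splitAll g []           []       _        = unaffected [] ≅-refl λ _ → refl
      splitAll g {b ∷ bs} (uniq ∷ us) (p ∷ ps) loopless =
        let eq = trans (sym (countEdge-++ u u (edges b p) (allEdges ps))) loopless in
        transport (λ (q , qs) → q ∷ qs) (λ _ → refl) (combine
          (splitPiece g b uniq p (m+n≡0⇒m≡0 _ eq))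
          (splitAll (suc g) us ps (m+n≡0⇒n≡0 (countEdge G u u (edges b p)) eq)))

      weight-u : weight B u ≡ 2 + k
      weight-u = trans (count-↭ u before) (trans (count-++ u (replicate (2 + k) u) R)
        (trans (cong₂ _+_ (count-replicate u (2 + k)) (count-∉ u∉R)) (+-identityʳ _)))

      weight-u′ : weight B u′ ≡ 0
      weight-u′ rewrite part≡ = trans (count-↭ u′ before) (trans (count-++ u′ (replicate (2 + k) u) R)
        (cong₂ _+_ (count-replicate-≢ (2 + k) u′≢u) (count-∉ u′∉R)))

      weight′-u : weight B′ u ≡ 1 + k
      weight′-u = trans (count-↭ u after) (trans (count-++ u (u′ ∷ []) _)
        (trans (cong₂ _+_ (count-≢ (λ eq → u′≢u (sym eq))) (count-++ u (replicate (1 + k) u) R))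
        (trans (cong₂ _+_ (count-replicate u (1 + k)) (count-∉ u∉R)) (+-identityʳ _))))

      weight′-u′ : weight B′ u′ ≡ 1
      weight′-u′ rewrite part≡ = trans (count-↭ u′ after) (trans (count-++ u′ (u′ ∷ []) _)
        (cong₂ _+_ (count-refl u′) (trans (count-++ u′ (replicate (1 + k) u) R)
          (cong₂ _+_ (count-replicate-≢ (1 + k) u′≢u) (count-∉ u′∉R)))))

      weight′ : ∀ {v} → v ≢ u → v ≢ u′ → weight B′ v ≡ weight B v
      weight′ {v} v≢u v≢u′ with part v ≟I i
      ... | no  p≢i = cong (count v) (others (part v) p≢i)
      ... | yes p≡i rewrite p≡i = trans (count-↭ v after) (trans (count-++ v (u′ ∷ []) _)
        (trans (cong₂ _+_ (count-≢ v≢u′) (count-++ v (replicate (1 + k) u) R))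
        (trans (cong (_+ count v R) (count-replicate-≢ (1 + k) v≢u))
        (sym (trans (count-↭ v before) (trans (count-++ v (replicate (2 + k) u) R)
          (cong (_+ count v R) (count-replicate-≢ (2 + k) v≢u))))))))

      -- All weights that change lie in the part of `u`, where the factor `cross i` is 0; hence what
      -- a vertex of weight one is owed is the same before and after the split.
      cross-weight′ : ∀ v → cross i (part v) * weight B v ≡ cross i (part v) * weight B′ v
      cross-weight′ v with part v ≟I i
      ... | no  p≢i = cong (λ l → cross i (part v) * count v l) (sym (others (part v) p≢i))
      ... | yes p≡i rewrite p≡i | cross-diagonal i = refl

      -- The number of edges to `v` that a vertex of weight one in this part must have: the fraction
      -- 1/K of those between `u` and `v`.
      share : V → ℕ
      share v = cross i (part v) * weight B v

      share-u : share u ≡ 0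
      share-u = cong (_* weight B u) (cross-diagonal i)

      share-u′ : share u′ ≡ 0
      share-u′ = trans (cong (λ j → cross i j * weight B u′) part≡) (cong (_* weight B u′) (cross-diagonal i))

      module _ {E} neighbours inside (E≅ : E ≅ star u neighbours ++ inside)
        (away : ∀ v → countEdge G u v inside ≡ 0)
        (counts : ∀ a b → countEdge G a b E ≡ cross (part a) (part b) * (weight B a * weight B b)) where

        count-neighbours : ∀ v → count v neighbours ≡ (2 + k) * share v
        count-neighbours v = begin
          count v neighbours
            ≡⟨ +-identityʳ _ ⟨
          count v neighbours + 0
            ≡⟨ cong₂ _+_ (star-centre u v neighbours) (away v) ⟨
          countEdge G u v (star u neighbours) + countEdge G u v inside
            ≡⟨ countEdge-++ u v (star u neighbours) inside ⟨
          countEdge G u v (star u neighbours ++ inside)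
            ≡⟨ at E≅ u v ⟨
          countEdge G u v E
            ≡⟨ counts u v ⟩
          cross i (part v) * (weight B u * weight B v)
            ≡⟨ cong (λ n → cross i (part v) * (n * weight B v)) weight-u ⟩
          cross i (part v) * ((2 + k) * weight B v)
            ≡⟨ x∙yz≈y∙xz (cross i (part v)) (2 + k) (weight B v) ⟩
          (2 + k) * share v ∎
          where open ≡-Reasoning

        module _ {E′} moved kept (neighbours↭ : neighbours ↭ moved ++ kept)
          (E′≅ : E′ ≅ star u′ moved ++ star u kept ++ inside)
          (count-moved : ∀ v → count v moved ≡ share v) where

          count-kept : ∀ v → count v kept ≡ (1 + k) * share v
          count-kept v = +-cancelˡ-≡ (share v) _ _ (begin
            share v + count v kept              ≡⟨ cong (_+ count v kept) (count-moved v) ⟨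
            count v moved + count v kept   ≡⟨ count-++ v moved kept ⟨
            count v (moved ++ kept)          ≡⟨ count-↭ v neighbours↭ ⟨
            count v neighbours                  ≡⟨ count-neighbours v ⟩
            share v + (1 + k) * share v         ∎)
            where open ≡-Reasoning

          E-count : ∀ a b → countEdge G a b E ≡ countEdge G a b (star u neighbours) + countEdge G a b inside
          E-count a b = trans (at E≅ a b) (countEdge-++ a b (star u neighbours) inside)

          E′-count : ∀ a b → countEdge G a b E′ ≡
            countEdge G a b (star u′ moved) + (countEdge G a b (star u kept) + countEdge G a b inside)
          E′-count a b = trans (at E′≅ a b) (trans (countEdge-++ a b (star u′ moved) _)
            (cong (countEdge G a b (star u′ moved) +_) (countEdge-++ a b (star u kept) inside)))

          at-u : ∀ b → countEdge G u b E′ ≡ (1 + k) * share b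
          at-u b = trans (E′-count u b) (cong₂ _+_ moved≡0
            (trans (cong₂ _+_ (trans (star-centre u b kept) (count-kept b)) (away b)) (+-identityʳ _)))
            where
            moved≡0 : countEdge G u b (star u′ moved) ≡ 0
            moved≡0 with b ≟V u′
            ... | no b≢u′  = star-away moved (λ eq → u′≢u (sym eq)) b≢u′
            -- An edge between `u` and `u′` would need `u` among the moved ends, but the share of
            -- `u` is 0.
            ... | yes refl = trans (countEdge-comm u u′ (star u′ moved))
              (trans (star-centre u′ u moved) (trans (count-moved u) share-u))

          at-u′ : ∀ b → countEdge G u′ b E′ ≡ share b
          at-u′ b = trans (E′-count u′ b) (trans (cong₂ _+_ (trans (star-centre u′ b moved) (count-moved b))
            (cong₂ _+_ kept≡0 inside≡0)) (+-identityʳ _))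
            where
            kept≡0 : countEdge G u′ b (star u kept) ≡ 0
            kept≡0 with b ≟V u
            ... | no b≢u   = star-away kept u′≢u b≢u
            ... | yes refl = trans (countEdge-comm u′ u (star u kept))
              (trans (star-centre u u′ kept) (trans (count-kept u′)
                (trans (cong ((1 + k) *_) share-u′) (*-zeroʳ (1 + k)))))
            -- Before the split `u′` has weight 0, so by the invariant no edge touches it.
            inside≡0 : countEdge G u′ b inside ≡ 0
            inside≡0 = m+n≡0⇒n≡0 (countEdge G u′ b (star u neighbours)) (trans (sym (E-count u′ b))
              (trans (counts u′ b) (trans (cong (λ n → cross (part u′) (part b) * (n * weight B b)) weight-u′)
                (*-zeroʳ (cross (part u′) (part b))))))

          counts-u : ∀ b → countEdge G u b E′ ≡ cross i (part b) * (weight B′ u * weight B′ b)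
          counts-u b = trans (at-u b) (trans (cong ((1 + k) *_) (cross-weight′ b))
            (trans (x∙yz≈y∙xz (1 + k) (cross i (part b)) (weight B′ b))
              (cong (λ n → cross i (part b) * (n * weight B′ b)) (sym weight′-u))))

          counts-u′ : ∀ b → countEdge G u′ b E′ ≡ cross (part u′) (part b) * (weight B′ u′ * weight B′ b)
          counts-u′ b = trans (at-u′ b) (trans (cross-weight′ b) (cong₂ (λ j n → cross j (part b) * n) (sym part≡)
            (sym (trans (cong (_* weight B′ b) weight′-u′) (+-identityʳ _)))))

          mirror : ∀ a b → countEdge G b a E′ ≡ cross (part b) (part a) * (weight B′ b * weight B′ a) →
            countEdge G a b E′ ≡ cross (part a) (part b) * (weight B′ a * weight B′ b)
          mirror a b eq = trans (countEdge-comm a b E′) (trans eq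
            (cong₂ _*_ (cross-comm (part b) (part a)) (*-comm (weight B′ b) (weight B′ a))))

          counts′ : ∀ a b → countEdge G a b E′ ≡ cross (part a) (part b) * (weight B′ a * weight B′ b)
          counts′ a b with a ≟V u | a ≟V u′ | b ≟V u | b ≟V u′
          ... | yes refl | _        | _        | _        = counts-u b
          ... | no _     | yes refl | _        | _        = counts-u′ b
          ... | no _     | no _     | yes refl | _        = mirror a u (counts-u a)
          ... | no _     | no _     | no _     | yes refl = mirror a u′ (counts-u′ a)
          ... | no a≢u   | no a≢u′  | no b≢u   | no b≢u′  = begin
            countEdge G a b E′
              ≡⟨ E′-count a b ⟩
            countEdge G a b (star u′ moved) + (countEdge G a b (star u kept) + countEdge G a b inside)
              ≡⟨ cong₂ _+_ (star-away moved a≢u′ b≢u′) (cong (_+ countEdge G a b inside) (star-away kept a≢u b≢u)) ⟩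
            countEdge G a b inside
              ≡⟨ cong (_+ countEdge G a b inside) (star-away neighbours a≢u b≢u) ⟨
            countEdge G a b (star u neighbours) + countEdge G a b inside
              ≡⟨ E-count a b ⟨
            countEdge G a b E
              ≡⟨ counts a b ⟩
            cross (part a) (part b) * (weight B a * weight B b)
              ≡⟨ cong₂ (λ m n → cross (part a) (part b) * (m * n)) (weight′ a≢u a≢u′) (weight′ b≢u b≢u′) ⟨
            cross (part a) (part b) * (weight B′ a * weight B′ b) ∎
            where open ≡-Reasoning

    detachVertex : ∀ {bs} → All (Unique ∘ proj₂) bs → State B bs → State B′ bs
    detachVertex {bs} uniq (ps , counts) = detach (splitAll 0 uniq ps
        (trans (counts u u) (cong (_* (weight B u * weight B u)) (cross-diagonal i))))
      where
      destinations : List V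
      destinations = concatMap (λ v → replicate (share v) v) verts

      count-destinations : ∀ v → count v destinations ≡ share v
      count-destinations v = count-multiples share verts-unique (verts-complete v)

      detach : Splitting (0 ≤_) (allEdges ps) {All (Piece B′) bs} allEdges → State B′ bs
      detach S = conclude (Selection.selection (SumP.≡-dec _≟V_ _≟_) rows target lengths rows↭target)
        where
        open Splitting S

        -- Regularity on the side of the vertices: by the invariant at `u`, which has weight K, all
        -- pieces together offer each `v` exactly K times its share.
        neighbours↭ : neighbours ↭ copies (2 + k) destinations
        neighbours↭ = count-≡⇒↭ _ _ λ v → trans (count-neighbours neighbours inside E≅ away counts v)
          (sym (trans (count-copies v (2 + k) destinations) (cong ((2 + k) *_) (count-destinations v))))

        target : List (V ⊎ ℕ)
        target = map inj₁ destinations ++ map inj₂ labels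

        rows↭target : concat rows ↭ copies (2 + k) target
        rows↭target = begin
          concat rows
            ↭⟨ rows↭ ⟩
          map inj₁ neighbours ++ copies (2 + k) (map inj₂ labels)
            ↭⟨ ++⁺ʳ _ (map⁺ inj₁ neighbours↭) ⟩
          map inj₁ (copies (2 + k) destinations) ++ copies (2 + k) (map inj₂ labels)
            ≡⟨ cong (_++ copies (2 + k) (map inj₂ labels)) (copies-map inj₁ (2 + k) destinations) ⟨
          copies (2 + k) (map inj₁ destinations) ++ copies (2 + k) (map inj₂ labels)
            ↭⟨ copies-++ (2 + k) (map inj₁ destinations) (map inj₂ labels) ⟨
          copies (2 + k) target ∎
          where open PermutationReasoning

        conclude : (∃ λ qs → Pointwise _∈_ qs rows × qs ↭ target) → State B′ bs
        conclude (qs , qs∈ , qs↭) =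
          let ps′ , kept , N↭ , E′≅ = reattach qs∈
                (↭-trans (mapMaybe-↭ isInj₂ qs↭) (↭-reflexive (rights-map destinations labels)))
          in ps′ , counts′ neighbours inside E≅ away counts (lefts qs) kept N↭ E′≅ λ v → trans
               (count-↭ v (↭-trans (mapMaybe-↭ isInj₁ qs↭) (↭-reflexive (lefts-map destinations labels))))
               (count-destinations v)

  -- `R` collects the vertices of the part that already stand for themselves. Each vertex of `as`
  -- takes one unit from `u`, whose weight therefore ends at one.
  detachPart : ∀ {bs} u as {B} R → All (Unique ∘ proj₂) bs → Proper B →
    All (λ v → part v ≡ part u) as → Unique (u ∷ as ++ R) →
    B (part u) ↭ replicate (1 + length as) u ++ R → State B bs →
    ∃ λ B′ → B′ (part u) ↭ u ∷ as ++ R × (∀ j → j ≢ part u → B′ j ≡ B j) × Proper B′ × State B′ bs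
  detachPart u [] {B} R uniqs proper _ _ before st = B , before , (λ _ _ → refl) , proper , st
  detachPart {bs} u (a ∷ as) {B} R uniqs proper (part≡ ∷ parts≡) uniq before st =
    let B″ , contents , unchanged , proper″ , st″ = detachPart u as {B′} (a ∷ R) uniqs proper′ parts≡
          (Unique-resp-↭ (prep u (↭-sym (shift a as R))) uniq)
          (↭-trans after (↭-sym (shift a (replicate (1 + length as) u) R)))
          (detachVertex proper part≡ (λ a≡u → All.head (AllPairs.head uniq) (sym a≡u)) u∉R a∉R before after others uniqs st)
    in B″ , ↭-trans contents (prep u (shift a as R))
      , (λ j j≢ → trans (unchanged j j≢) (others j j≢)) , proper″ , st″
    where
    B′ : Contents
    B′ j with j ≟I part u
    ... | yes _ = a ∷ replicate (1 + length as) u ++ R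
    ... | no  _ = B j
    u∉R : u ∉ R
    u∉R u∈R = Unique[x∷xs]⇒x∉xs uniq (there (∈-++⁺ʳ as u∈R))
    a∉R : a ∉ R
    a∉R a∈R = Unique[x∷xs]⇒x∉xs (AllPairs.tail uniq) (∈-++⁺ʳ as a∈R)
    after : B′ (part u) ↭ a ∷ replicate (1 + length as) u ++ R
    after with part u ≟I part u
    ... | yes _ = refl
    ... | no ¬p = contradiction refl ¬p
    others : ∀ j → j ≢ part u → B′ j ≡ B j
    others j j≢ with j ≟I part u
    ... | yes j≡ = contradiction j≡ j≢
    ... | no  _  = refl
    proper′ : Proper B′
    proper′ j with j ≟I part u
    ... | no  _    = proper j
    ... | yes refl = part≡ ∷ AllP.++⁺ (AllP.replicate⁺ (1 + length as) refl)
      (AllP.++⁻ʳ (replicate (2 + length as) u) (All-resp-↭ before (proper j)))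

  module _ (root : I → V) (rest : I → List V) (part-root : ∀ i → part (root i) ≡ i)
    (part-rest : ∀ i → All (λ v → part v ≡ i) (rest i)) (columns-unique : ∀ i → Unique (root i ∷ rest i)) where

    -- The parts in `js` are still concentrated at their roots and the others fully spread out. A
    -- split alters the contents of its own part only, so finished parts stay finished.
    detachParts : ∀ {bs} js {B} → All (Unique ∘ proj₂) bs → Unique js → Proper B →
      (∀ j → j ∈ js → B j ↭ replicate (1 + length (rest j)) (root j)) →
      (∀ j → j ∉ js → B j ↭ root j ∷ rest j) → State B bs →
      ∃ λ B′ → (∀ j → B′ j ↭ root j ∷ rest j) × State B′ bs
    detachParts [] {B} uniqs _ _ _ done st = B , (λ j → done j λ ()) , st
    detachParts (j ∷ js) {B} uniqs uniq proper todo done st with part (root j) in eq | part-root j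
    ... | .j | refl = detachParts js uniqs (AllPairs.tail uniq) (proj₁ (proj₂ (proj₂ (proj₂ step))))
        (λ x x∈ → ↭-trans (↭-reflexive (others x λ { refl → Unique[x∷xs]⇒x∉xs uniq x∈ })) (todo x (there x∈)))
        done′ (proj₂ (proj₂ (proj₂ (proj₂ step))))
      where
      step : ∃ λ B′ → B′ j ↭ root j ∷ rest j × (∀ x → x ≢ j → B′ x ≡ B x) × Proper B′ × State B′ _
      step = subst (λ i → ∃ λ B′ → B′ i ↭ root j ∷ rest j × (∀ x → x ≢ i → B′ x ≡ B x) × Proper B′ × State B′ _) eq
        (let B′ , p , q = detachPart (root j) (rest j) {B} [] uniqs proper
               (All.map (λ p → trans p (sym (part-root j))) (part-rest j))
               (subst (λ l → Unique (root j ∷ l)) (sym (++-identityʳ (rest j))) (columns-unique j))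
               (↭-trans (↭-reflexive (cong B eq)) (↭-trans (todo j (here refl)) (↭-reflexive (sym (++-identityʳ _))))) st
         in B′ , ↭-trans p (↭-reflexive (cong (root j ∷_) (++-identityʳ (rest j)))) , q)
      others = proj₁ (proj₂ (proj₂ step))
      done′ : ∀ x → x ∉ js → proj₁ step x ↭ root x ∷ rest x
      done′ x x∉ with x ≟I j
      ... | yes refl = proj₁ (proj₂ step)
      ... | no  x≢j  = ↭-trans (↭-reflexive (others x x≢j)) (done x λ { (here x≡j) → x≢j x≡j ; (there q) → x∉ q })

-- Blowing up a factorization of the complete multigraph

Unique-concat⁻ : ∀ (xss : List (List A)) → Unique (concat xss) → All Unique xss
Unique-concat⁻ []         _    = []
Unique-concat⁻ (xs ∷ xss) uniq = Unique-++⁻ˡ xs uniq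
  ∷ Unique-concat⁻ xss (Unique-++⁻ˡ (concat xss) (Unique-resp-↭ (++-comm-↭ xs (concat xss)) uniq))

concatMap-cong-↭ : ∀ {f g : A → List C} → (∀ x → f x ↭ g x) → ∀ xs → concatMap f xs ↭ concatMap g xs
concatMap-cong-↭ f↭g []       = refl
concatMap-cong-↭ f↭g (x ∷ xs) = ++⁺ (f↭g x) (concatMap-cong-↭ f↭g xs)

concatMap-replicate-↭ : ∀ k (f : A → C) xs → concatMap (λ x → replicate k (f x)) xs ↭ copies k (map f xs)
concatMap-replicate-↭ k f []       = ↭-reflexive (sym (copies-[] k))
concatMap-replicate-↭ k f (x ∷ xs) = ↭-trans
  (++⁺ (↭-reflexive (replicate-copies k)) (concatMap-replicate-↭ k f xs)) (↭-sym (copies-++ k (f x ∷ []) (map f xs)))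
  where
  replicate-copies : ∀ k → replicate k (f x) ≡ copies k (f x ∷ [])
  replicate-copies zero    = refl
  replicate-copies (suc k) = cong (f x ∷_) (replicate-copies k)

cartesianProduct-concatMap : ∀ (xs : List A) (ys : List C) →
  cartesianProduct xs ys ≡ concatMap (λ x → map (x ,_) ys) xs
cartesianProduct-concatMap []       ys = refl
cartesianProduct-concatMap (x ∷ xs) ys = cong (map (x ,_) ys ++_) (cartesianProduct-concatMap xs ys)

module BlowUp (lam m′ n : ℕ) where
  m = suc m′
  K = completeMulti (lam * m) n
  H = completeMultipartite lam n m
  module K = Walks K
  open Walks H

  cross : Fin n → Fin n → ℕ
  cross i j = if ⌊ i FinP.≟ j ⌋ then 0 else lam

  cross-diagonal : ∀ i → cross i i ≡ 0
  cross-diagonal i with i FinP.≟ i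
  ... | yes _ = refl
  ... | no ¬p = contradiction refl ¬p

  cross-comm : ∀ i j → cross i j ≡ cross j i
  cross-comm i j with i FinP.≟ j | j FinP.≟ i
  ... | yes _ | yes _ = refl
  ... | no _  | no _  = refl
  ... | yes p | no ¬q = contradiction (sym p) ¬q
  ... | no ¬p | yes q = contradiction (sym q) ¬p

  open Detachment H FinP._≟_ proj₁ cross cross-diagonal cross-comm
    (cartesianProduct⁺ (allFin⁺ n) (allFin⁺ m))
    (λ (i , a) → ∈-cartesianProduct⁺ (∈-allFin i) (∈-allFin a))
  open Counting (Graph._≟V_ H)
  open CountUnique (Graph._≟V_ H)

  root : Fin n → Fin n × Fin m
  root i = i , zero

  rootEdges : K.Edges → Edges
  rootEdges = map λ (i , j) → root i , root j

  rest : Fin n → List (Fin n × Fin m)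
  rest i = map (i ,_) (tabulate suc)

  concentrated : Contents
  concentrated i = replicate m (root i)

  countEdge-root : ∀ i j es → countEdge H (root i) (root j) (rootEdges es) ≡ countEdge K i j es
  countEdge-root i j []             = refl
  countEdge-root i j ((x , y) ∷ es) = trans (countEdge-++ (root i) (root j) ((root x , root y) ∷ []) (rootEdges es))
    (trans (cong₂ _+_ (one (((x FinP.≟ i) ×-dec (y FinP.≟ j)) ⊎-dec ((x FinP.≟ j) ×-dec (y FinP.≟ i))))
      (countEdge-root i j es)) (sym (K.countEdge-++ i j ((x , y) ∷ []) es)))
    where
    one : Dec ((x ≡ i × y ≡ j) ⊎ (x ≡ j × y ≡ i)) →
      countEdge H (root i) (root j) ((root x , root y) ∷ []) ≡ countEdge K i j ((x , y) ∷ [])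
    one (yes (inj₁ (refl , refl))) = trans (countEdge-one (root i) (root j) (root x) (root y) (inj₁ (refl , refl))) (sym (K.countEdge-one i j x y (inj₁ (refl , refl))))
    one (yes (inj₂ (refl , refl))) = trans (countEdge-one (root i) (root j) (root x) (root y) (inj₂ (refl , refl))) (sym (K.countEdge-one i j x y (inj₂ (refl , refl))))
    one (no ¬j) = trans
      (countEdge-none (root i) (root j) ((root x , root y) ∷ []) λ where
        (here refl) (inj₁ (refl , refl)) → ¬j (inj₁ (refl , refl))
        (here refl) (inj₂ (refl , refl)) → ¬j (inj₂ (refl , refl)))
      (sym (K.countEdge-none i j ((x , y) ∷ []) λ where (here refl) → ¬j))

  countEdge-nonroot : ∀ i a v es → countEdge H (i , suc a) v (rootEdges es) ≡ 0
  countEdge-nonroot i a v es = countEdge-∉ (rootEdges es) (nonroot es) v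
    where
    nonroot : ∀ es → (i , suc a) ∉ endpoints (rootEdges es)
    nonroot (e ∷ es) (there (there p)) = nonroot es p

  cycEdges-root : ∀ c → cycEdges H (map root c) ≡ rootEdges (cycEdges K c)
  cycEdges-root []       = refl
  cycEdges-root (x ∷ xs) = trans (cycEdges-links (root x) (map root xs))
    (trans (links-root x xs x) (cong rootEdges (sym (K.cycEdges-links x xs))))
    where
    links-root : ∀ x xs y → links (root x) (map root xs) (root y) ≡ rootEdges (K.links x xs y)
    links-root x []       y = refl
    links-root x (z ∷ zs) y = cong ((root x , root z) ∷_) (links-root z zs y)

  endpoints-root : ∀ es → endpoints (rootEdges es) ≡ map root (K.endpoints es)
  endpoints-root []       = refl
  endpoints-root (e ∷ es) = cong (λ l → _ ∷ _ ∷ l) (endpoints-root es)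

  endpoints-copies : ∀ k es → endpoints (copies k es) ≡ copies k (endpoints es)
  endpoints-copies zero    es = refl
  endpoints-copies (suc k) es = trans (concatMap-++ _ es (copies k es))
    (cong (endpoints es ++_) (endpoints-copies k es))

  pairBases : Maybe (OneFactor K) → List (Kind × List (Fin n))
  pairBases nothing         = []
  pairBases (just (es , _)) = (pairs , K.endpoints es) ∷ []

  -- The cycles of all 2-factors form one list, because a split must balance its edges over all
  -- factors at once. Their order is kept, which lets `takeCycles` restore the grouping into
  -- 2-factors.
  bases : ∀ {T} → List (TwoFactor K T) → Maybe (OneFactor K) → List (Kind × List (Fin n))
  bases []       M = pairBases M
  bases (F ∷ Fs) M = map (cycle ,_) (proj₁ F) ++ bases Fs M

  -- Every cycle is gone round m times and every edge of the 1-factor repeated m times.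
  Concentrated : List (Kind × List (Fin n)) → K.Edges → Set
  Concentrated bs es = ∃ λ (ps : All (Piece concentrated) bs) → allEdges ps ≅ copies m (rootEdges es)

  addCycles : ∀ cs {bs es} → Concentrated bs es →
    Concentrated (map (cycle ,_) cs ++ bs) (concatMap (cycEdges K) cs ++ es)
  addCycles []            st = st
  addCycles (c ∷ cs) {es = es} st =
    let ps , ps≅ = addCycles cs st
        es′ = concatMap (cycEdges K) cs ++ es
    in (copies m (map root c) , ↭-sym (concatMap-replicate-↭ m root c)) ∷ ps , (begin
      cycEdges H (copies m (map root c)) ++ allEdges ps
        ≈⟨ ≅-++ (≅-reflexive (trans (cycEdges-copies m′ (map root c)) (cong (copies m) (cycEdges-root c)))) ps≅ ⟩
      copies m (rootEdges (cycEdges K c)) ++ copies m (rootEdges es′)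
        ≈⟨ ↭⇒≅ (copies-++ m (rootEdges (cycEdges K c)) (rootEdges es′)) ⟨
      copies m (rootEdges (cycEdges K c) ++ rootEdges es′)
        ≡⟨ cong (copies m) (map-++ _ (cycEdges K c) es′) ⟨
      copies m (rootEdges (cycEdges K c ++ es′))
        ≡⟨ cong (λ l → copies m (rootEdges l)) (++-assoc (cycEdges K c) _ es) ⟨
      copies m (rootEdges (concatMap (cycEdges K) (c ∷ cs) ++ es)) ∎)
    where open ≅-Reasoning

  baseEdges : ∀ {T} → List (TwoFactor K T) → Maybe (OneFactor K) → K.Edges
  baseEdges []       M = oneFactorEdges K M
  baseEdges (F ∷ Fs) M = twoFactorEdges K F ++ baseEdges Fs M

  concentrate : ∀ {T} (Fs : List (TwoFactor K T)) M → Concentrated (bases Fs M) (baseEdges Fs M)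
  concentrate []       nothing         = [] , ≅-reflexive (sym (copies-[] m))
  concentrate []       (just (es , _)) =
    (copies m (rootEdges es) , ↭-trans
      (↭-reflexive (trans (endpoints-copies m (rootEdges es)) (cong (copies m) (endpoints-root es))))
      (↭-sym (concatMap-replicate-↭ m root (K.endpoints es)))) ∷ [] , ≅-reflexive (++-identityʳ _)
  concentrate (F ∷ Fs) M               = addCycles (proj₁ F) (concentrate Fs M)

  bases-unique : ∀ {T} (Fs : List (TwoFactor K T)) M → All (Unique ∘ proj₂) (bases Fs M)
  bases-unique []       nothing             = []
  bases-unique []       (just (_ , _ , p↭)) = Unique-resp-↭ (↭-sym p↭) (allFin⁺ n) ∷ []
  bases-unique ((cs , _ , cs↭ , _) ∷ Fs) M  =
    AllP.++⁺ (AllP.map⁺ (Unique-concat⁻ cs (Unique-resp-↭ (↭-sym cs↭) (allFin⁺ n)))) (bases-unique Fs M)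

  countEdge-baseEdges : ∀ {T} (Fs : List (TwoFactor K T)) M i j → countEdge K i j (baseEdges Fs M) ≡
    sum (map (λ F → countEdge K i j (twoFactorEdges K F)) Fs) + countEdge K i j (oneFactorEdges K M)
  countEdge-baseEdges []       M i j = refl
  countEdge-baseEdges (F ∷ Fs) M i j = trans (K.countEdge-++ i j (twoFactorEdges K F) (baseEdges Fs M))
    (trans (cong (countEdge K i j (twoFactorEdges K F) +_) (countEdge-baseEdges Fs M i j))
      (sym (+-assoc (countEdge K i j (twoFactorEdges K F)) _ _)))

  -- `OP` counts edges between distinct vertices only, whereas `State` also speaks of the diagonal.
  -- The gap is closed by the shape of the factors: cycles of length at least two without repeated
  -- vertices, and pairs of distinct vertices.
  baseEdges-loopless : ∀ {T} (Fs : List (TwoFactor K T)) M → K.Loopless (baseEdges Fs M)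
  baseEdges-loopless []       nothing               = λ _ → refl
  baseEdges-loopless []       (just (es , es≢ , _)) = loopless es≢
    where
    loopless : ∀ {es} → All (λ e → proj₁ e ≢ proj₂ e) es → K.Loopless es
    loopless []         = λ _ → refl
    loopless (e≢ ∷ es≢) = K.loopless-∷ e≢ (loopless es≢)
  baseEdges-loopless ((cs , long , cs↭ , _) ∷ Fs) M =
    K.loopless-++ (concatMap (cycEdges K) cs) (baseEdges Fs M) (loopless long (Unique-concat⁻ cs (Unique-resp-↭ (↭-sym cs↭) (allFin⁺ n)))) (baseEdges-loopless Fs M)
    where
    loopless : ∀ {cs} → All (λ c → 2 ≤ length c) cs → All Unique cs → K.Loopless (concatMap (cycEdges K) cs)
    loopless []         []             = λ _ → refl
    loopless {c ∷ cs} (l ∷ long) (uniq ∷ uniqs) = K.loopless-++ (cycEdges K c) (concatMap (cycEdges K) cs) (K.cycEdges-loopless uniq l) (loopless long uniqs)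

  initial : ∀ {T} (Fs : List (TwoFactor K T)) M →
    (∀ i j → i ≢ j → countEdge K i j (baseEdges Fs M) ≡ Graph.mult K i j) → State concentrated (bases Fs M)
  initial Fs M decomposes = ps , λ a b → trans (at ps≅ a b) (trans (countEdge-copies a b m (rootEdges es)) (counts a b))
    where
    ps  = proj₁ (concentrate Fs M)
    ps≅ = proj₂ (concentrate Fs M)
    es  = baseEdges Fs M
    weight-root : ∀ i → weight concentrated (root i) ≡ m
    weight-root i = count-replicate (root i) m
    weight-nonroot : ∀ i a → weight concentrated (i , suc a) ≡ 0
    weight-nonroot i a = count-replicate-≢ {i , suc a} {root i} m λ ()
    counts-nonroot : ∀ i a v →
      m * countEdge H (i , suc a) v (rootEdges es) ≡ cross i (proj₁ v) * (weight concentrated (i , suc a) * weight concentrated v)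
    counts-nonroot i a v = trans (cong (m *_) (countEdge-nonroot i a v es)) (trans (*-zeroʳ m)
      (sym (trans (cong (λ w → cross i (proj₁ v) * (w * weight concentrated v)) (weight-nonroot i a))
        (*-zeroʳ (cross i (proj₁ v))))))
    counts-root : ∀ i j → m * countEdge K i j es ≡ cross i j * (m * m)
    counts-root i j with i FinP.≟ j in eq
    ... | yes refl = trans (cong (m *_) (baseEdges-loopless Fs M i)) (*-zeroʳ m)
    ... | no  i≢j  = trans (cong (m *_) (trans (decomposes i j i≢j) (cong (λ d → if ⌊ d ⌋ then 0 else lam * m) eq)))
      (x∙yz≈y∙xz m lam m)
    counts : ∀ a b → m * countEdge H a b (rootEdges es) ≡
      cross (proj₁ a) (proj₁ b) * (weight concentrated a * weight concentrated b)
    counts (i , suc a) v           = counts-nonroot i a v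
    counts (i , zero)  (j , suc b) = trans (cong (m *_) (countEdge-comm (root i) (j , suc b) (rootEdges es)))
      (trans (counts-nonroot j b (root i)) (cong₂ _*_ (cross-comm j i)
        (*-comm (weight concentrated (j , suc b)) (weight concentrated (root i)))))
    counts (i , zero)  (j , zero)  = trans (cong (m *_) (countEdge-root i j es)) (trans (counts-root i j)
      (sym (cong₂ (λ x y → cross i j * (x * y)) (weight-root i) (weight-root j))))

  column : Contents
  column i = map (i ,_) (allFin m)

  column-unique : ∀ i → Unique (column i)
  column-unique i = Unique-map⁺ (cong proj₂) (allFin⁺ m)

  module _ {B : Contents} (B↭ : ∀ i → B i ↭ column i) where

    length-contents : ∀ c → length (concatMap B c) ≡ m * length c
    length-contents []      = sym (*-zeroʳ m)
    length-contents (i ∷ c) = trans (length-++ (B i)) (trans (cong₂ _+_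
      (trans (↭-length (B↭ i)) (trans (length-map (i ,_) (allFin m)) (length-tabulate {n = m} id))) (length-contents c))
      (sym (*-suc m (length c))))

    contents-all : ∀ {c} → c ↭ allFin n → concatMap B c ↭ Graph.verts H
    contents-all c↭ = ↭-trans (concatMap-↭ B c↭) (↭-trans (concatMap-cong-↭ B↭ (allFin n))
      (↭-reflexive (sym (cartesianProduct-concatMap (allFin n) (allFin m)))))

    weight-one : ∀ v → weight B v ≡ 1
    weight-one v@(i , a) = trans (count-↭ v (B↭ i))
      (count-unique (column-unique i) (∈-map⁺ (i ,_) (∈-allFin a)))

    takeCycles : ∀ cs {bs} (ps : All (Piece B) (map (cycle ,_) cs ++ bs)) →
      ∃₂ λ ws (qs : All (Piece B) bs) → Pointwise (λ w c → w ↭ concatMap B c) ws cs ×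
        allEdges ps ≡ concatMap (cycEdges H) ws ++ allEdges qs
    takeCycles []       ps              = [] , ps , [] , refl
    takeCycles (c ∷ cs) ((w , w↭) ∷ ps) =
      let ws , qs , ws↭ , eq = takeCycles cs ps
      in w ∷ ws , qs , w↭ ∷ ws↭ , trans (cong (cycEdges H w ++_) eq) (sym (++-assoc (cycEdges H w) _ _))

    -- Once the contents are whole columns, a walk over a cycle of length l has m · l vertices, and
    -- the walks over one 2-factor together use every vertex once. So no walk repeats a vertex: the
    -- closed walks have become cycles.
    twoFactor : ∀ {T ws cs} → Pointwise (λ w c → w ↭ concatMap B c) ws cs →
      All (λ c → 2 ≤ length c) cs → concat cs ↭ allFin n → map length cs ↭ T →
      All (λ w → 2 ≤ length w) ws × concat ws ↭ Graph.verts H × map length ws ↭ scaleType m T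
    twoFactor ws↭ long cs↭ type = long′ ws↭ long
      , ↭-trans (concat-contents ws↭) (contents-all cs↭)
      , ↭-trans (↭-reflexive (lengths ws↭)) (map⁺ (m *_) type)
      where
      lengths : ∀ {ws cs} → Pointwise (λ w c → w ↭ concatMap B c) ws cs → map length ws ≡ map (m *_) (map length cs)
      lengths []                  = refl
      lengths (_∷_ {y = c} w↭ ws↭) = cong₂ _∷_ (trans (↭-length w↭) (length-contents c)) (lengths ws↭)
      long′ : ∀ {ws cs} → Pointwise (λ w c → w ↭ concatMap B c) ws cs →
        All (λ c → 2 ≤ length c) cs → All (λ w → 2 ≤ length w) ws
      long′ []                   []       = []
      long′ (_∷_ {y = c} w↭ ws↭) (l ∷ ls) =
        subst (2 ≤_) (sym (trans (↭-length w↭) (length-contents c))) (≤-trans l (m≤m+n (length c) _)) ∷ long′ ws↭ ls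
      concat-contents : ∀ {ws cs} → Pointwise (λ w c → w ↭ concatMap B c) ws cs → concat ws ↭ concatMap B (concat cs)
      concat-contents []                   = refl
      concat-contents (_∷_ {y = c} w↭ ws↭) = ↭-trans (++⁺ w↭ (concat-contents ws↭))
        (↭-reflexive (sym (concatMap-++ B c _)))

    -- Looplessness is carried along for the sake of the 1-factor: that the two ends of each of its
    -- edges differ is known only through the edge counts.
    factorise : ∀ {T} (Fs : List (TwoFactor K T)) M (ps : All (Piece B) (bases Fs M)) → Loopless (allEdges ps) →
      Σ (List (TwoFactor H (scaleType m T))) λ Fs′ → Σ (Maybe (OneFactor H)) λ M′ → ∀ u v →
        sum (map (λ F → countEdge H u v (twoFactorEdges H F)) Fs′) + countEdge H u v (oneFactorEdges H M′) ≡
          countEdge H u v (allEdges ps)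
    factorise []       nothing              []               loopless = [] , nothing , λ _ _ → refl
    factorise []       (just (_ , _ , es↭)) ((es , p↭) ∷ []) loopless =
      [] , just (es , All.tabulate distinct , ↭-trans p↭ (contents-all es↭)) ,
        λ u v → cong (countEdge H u v) (sym (++-identityʳ es))
      where
      distinct : ∀ {e} → e ∈ es → proj₁ e ≢ proj₂ e
      distinct e∈ refl = countEdge-∈ (∈-++⁺ˡ e∈) (loopless _)
    factorise ((cs , long , cs↭ , type) ∷ Fs) M ps loopless with takeCycles cs ps
    ... | ws , qs , ws↭ , eq =
      let Fs′ , M′ , counts = factorise Fs M qs λ v → m+n≡0⇒n≡0 (countEdge H v v (concatMap (cycEdges H) ws))
            (trans (sym (countEdge-++ v v (concatMap (cycEdges H) ws) (allEdges qs)))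
              (trans (cong (countEdge H v v) (sym eq)) (loopless v)))
      in (ws , twoFactor ws↭ long cs↭ type) ∷ Fs′ , M′ , λ u v →
        trans (+-assoc (countEdge H u v (concatMap (cycEdges H) ws)) _ _)
        (trans (cong (countEdge H u v (concatMap (cycEdges H) ws) +_) (counts u v))
        (trans (sym (countEdge-++ u v (concatMap (cycEdges H) ws) (allEdges qs))) (cong (countEdge H u v) (sym eq))))

  blowUp : ∀ {T} → OP K T → OP H (scaleType m T)
  blowUp (Fs , M , decomposes) =
    let B , B↭ , ps , counts = detachParts root rest (λ _ → refl) (λ i → AllP.map⁺ (All.universal (λ _ → refl) _))
          column-unique (allFin n) {concentrated} (bases-unique Fs M) (allFin⁺ n)
          (λ i → AllP.replicate⁺ m refl)
          (λ i _ → ↭-reflexive (cong (λ k → replicate (suc k) (root i))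
            (sym (trans (length-map (i ,_) (tabulate {n = m′} suc)) (length-tabulate {A = Fin m} {n = m′} suc)))))
          (λ i i∉ → contradiction (∈-allFin i) i∉)
          (initial Fs M λ i j i≢j → trans (countEdge-baseEdges Fs M i j) (decomposes i j i≢j))
        Fs′ , M′ , factors = factorise B↭ Fs M ps λ v →
          trans (counts v v) (cong (_* (weight B v * weight B v)) (cross-diagonal (proj₁ v)))
    in Fs′ , M′ , λ u v _ → trans (factors u v) (trans (counts u v)
      (trans (cong₂ (λ x y → cross (proj₁ u) (proj₁ v) * (x * y)) (weight-one B↭ u) (weight-one B↭ v))
        (*-identityʳ (cross (proj₁ u) (proj₁ v)))))

theorem6p1 : (lam m n : ℕ) (T : List ℕ) → 1 ≤ lam → 1 ≤ m → 1 ≤ n →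
    OP (completeMulti (lam * m) n) T →
    OP (completeMultipartite lam n m) (scaleType m T)
theorem6p1 lam (suc m′) n T _ _ _ = BlowUp.blowUp lam m′ n
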